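{- There is a club (closed unbounded set) $A\subseteq\omega_1$ which is an antichain with respect to $\le_s$; that is, for any two distinct $\alpha,\beta\in A$ we have $\alpha\not\le_s\beta$ and $\beta\not\le_s\alpha$.
   Context: Work in ZFC. Ordinals are identified with the linear orders $(\eta,<)$. All languages are countable. A copy of a countable structure $\mathcal{A}$ is an isomorphic structure with domain $\omega$ (identified with its atomic diagram, a subset of $\omega$). $\Phi_e$ denotes the $e$-th Turing functional. For countable structures, $\mathcal{A}\le_s\mathcal{B}$ (Medvedev reducibility) means: there is $e\in\omega$ such that for every copy $B$ of $\mathcal{B}$, $\Phi_e^B$ is total and is (the atomic diagram of) a copy of $\mathcal{A}$. -}

module Defs where

open import Data.Bool using (Bool; true; false; T)
open import Data.Fin using (Fin)
open import Data.Nat using (ℕ; zero; suc; _+_)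
import Data.Nat as ℕ
open import Data.Product using (∃; _×_)
open import Data.Vec using (Vec; []; _∷_; lookup)
open import Function.Bundles using (_↣_)
open import Induction.WellFounded using (WellFounded)
open import Level using (0ℓ; _⊔_) renaming (suc to lsuc)
open import Relation.Binary.Core using (Rel)
open import Relation.Binary.Definitions using (_Respects_)
open import Relation.Binary.Morphism.Structures using (IsOrderIsomorphism)
open import Relation.Binary.PropositionalEquality using (_≡_)
open import Relation.Binary.Structures using (IsStrictTotalOrder)
open import Relation.Unary using (Pred)

Isomorphic : {X Y : Set} → Rel X 0ℓ → Rel Y 0ℓ → Set
Isomorphic _<₁_ _<₂_ = ∃ λ f → IsOrderIsomorphism _≡_ _≡_ _<₁_ _<₂_ f

-- Countable ordinals, presented as countable well-orders.  Equality of
-- ordinals is isomorphism (_≅_ below), not propositional equality.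

record ω₁ : Set₁ where
  infix 4 _<_
  field
    Carrier            : Set
    _<_                : Rel Carrier 0ℓ
    isStrictTotalOrder : IsStrictTotalOrder _≡_ _<_
    wellFounded        : WellFounded _<_
    countable          : Carrier ↣ ℕ

open ω₁ using (Carrier)

infix 4 _≅_ _≺_

_≅_ : Rel ω₁ 0ℓ
α ≅ β = Isomorphic (ω₁._<_ α) (ω₁._<_ β)

-- α ≺ β: α is isomorphic, via `embed`, to the proper initial segment
-- of β consisting of the elements below `bound`.

record _≺_ (α β : ω₁) : Set where
  private
    module α = ω₁ α
    module β = ω₁ β
  field
    bound : Carrier β
    embed : Carrier α → Carrier β
    mono  : ∀ {x y} → x α.< y → embed x β.< embed y
    below : ∀ x → embed x β.< bound
    onto  : ∀ {y} → y β.< bound → ∃ λ x → embed x ≡ y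

IsLimit : Pred ω₁ (lsuc 0ℓ)
IsLimit δ = Carrier δ × (∀ {α} → α ≺ δ → ∃ λ β → α ≺ β × β ≺ δ)

UnboundedBelow : ∀ {ℓ} → Pred ω₁ ℓ → ω₁ → Set _
UnboundedBelow A δ = ∀ {α} → α ≺ δ → ∃ λ β → A β × α ≺ β × β ≺ δ

-- A predicate is a set of ordinals only if it respects _≅_.

record IsClub {ℓ} (A : Pred ω₁ ℓ) : Set (lsuc 0ℓ ⊔ ℓ) where
  field
    respects  : A Respects _≅_
    closed    : ∀ {δ} → IsLimit δ → UnboundedBelow A δ → A δ
    unbounded : ∀ α → ∃ λ β → A β × α ≺ β

-- Subsets of ω are given by their characteristic functions.

Subset : Set
Subset = ℕ → Bool

bit : Bool → ℕ
bit false = 0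
bit true  = 1

-- Kleene's schemes for functions partial recursive in an oracle.  The
-- programs of arity 1 serve as the indices e of the Turing functionals.

data Program : ℕ → Set where
  zer  : ∀ {n} → Program n
  succ : Program 1
  ask  : Program 1
  proj : ∀ {n} → Fin n → Program n
  comp : ∀ {m n} → Program m → Vec (Program n) m → Program n
  prec : ∀ {n} → Program n → Program (suc (suc n)) → Program (suc n)
  mu   : ∀ {n} → Program (suc n) → Program n

-- B ⊢ p · xs ⇓ y: with oracle B, the program p halts on input xs with
-- output y.

infix 4 _⊢_·_⇓_ _⊢_·_⇊_

data _⊢_·_⇓_ (B : Subset) : ∀ {n} → Program n → Vec ℕ n → ℕ → Set
data _⊢_·_⇊_ (B : Subset) {n} : ∀ {m} → Vec (Program n) m → Vec ℕ n → Vec ℕ m → Set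

data _⊢_·_⇓_ B where
  zer⇓   : ∀ {n} {xs : Vec ℕ n} → B ⊢ zer · xs ⇓ 0
  succ⇓  : ∀ {x} → B ⊢ succ · x ∷ [] ⇓ suc x
  ask⇓   : ∀ {x} → B ⊢ ask · x ∷ [] ⇓ bit (B x)
  proj⇓  : ∀ {n} {i : Fin n} {xs} → B ⊢ proj i · xs ⇓ lookup xs i
  comp⇓  : ∀ {m n} {p : Program m} {qs : Vec (Program n) m} {xs ys z} →
           B ⊢ qs · xs ⇊ ys → B ⊢ p · ys ⇓ z → B ⊢ comp p qs · xs ⇓ z
  prec⇓₀ : ∀ {n} {p : Program n} {q xs y} →
           B ⊢ p · xs ⇓ y → B ⊢ prec p q · 0 ∷ xs ⇓ y
  prec⇓₁ : ∀ {n} {p : Program n} {q k xs y z} →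
           B ⊢ prec p q · k ∷ xs ⇓ y → B ⊢ q · k ∷ y ∷ xs ⇓ z →
           B ⊢ prec p q · suc k ∷ xs ⇓ z
  mu⇓    : ∀ {n} {p : Program (suc n)} {xs y} →
           (∀ {k} → k ℕ.< y → ∃ λ v → B ⊢ p · k ∷ xs ⇓ suc v) →
           B ⊢ p · y ∷ xs ⇓ 0 → B ⊢ mu p · xs ⇓ y

data _⊢_·_⇊_ B {n} where
  []  : ∀ {xs} → B ⊢ [] · xs ⇊ []
  _∷_ : ∀ {m} {q : Program n} {qs : Vec (Program n) m} {xs y ys} →
        B ⊢ q · xs ⇓ y → B ⊢ qs · xs ⇊ ys → B ⊢ q ∷ qs · xs ⇊ y ∷ ys

-- Φ e , B ≐ D: the functional Φ_e with oracle B is total and is (the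
-- characteristic function of) D.

Φ_,_≐_ : Program 1 → Subset → Subset → Set
Φ e , B ≐ D = ∀ n → B ⊢ e · n ∷ [] ⇓ bit (D n)

-- Cantor's pairing bijection ℕ × ℕ → ℕ.

triangle : ℕ → ℕ
triangle zero    = 0
triangle (suc n) = suc n + triangle n

⟨_,_⟩ : ℕ → ℕ → ℕ
⟨ m , n ⟩ = triangle (m + n) + n

-- A subset D of ω is read as the atomic diagram of the structure with
-- domain ω in which m < n holds iff ⟨ m , n ⟩ ∈ D.  Atomic equalities
-- between elements of ω carry no information and are omitted.

diagram : Subset → Rel ℕ 0ℓ
diagram D m n = T (D ⟨ m , n ⟩)

_IsCopyOf_ : {X : Set} → Subset → Rel X 0ℓ → Set
D IsCopyOf _<_ = Isomorphic (diagram D) _<_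

MedvedevReducible : {X Y : Set} → Rel X 0ℓ → Rel Y 0ℓ → Set
MedvedevReducible _<₁_ _<₂_ =
  ∃ λ e → ∀ B → B IsCopyOf _<₂_ → ∃ λ D → Φ e , B ≐ D × D IsCopyOf _<₁_

infix 4 _≤ₛ_

_≤ₛ_ : Rel ω₁ 0ℓ
α ≤ₛ β = MedvedevReducible (ω₁._<_ α) (ω₁._<_ β)

{-# OPTIONS --safe #-}

-- Given a functional Φ e, force with finite partial injective enumerations
-- of countable ordinals and let "p forces m to have rank at least ξ" refer
-- to the order that Φ e computes from the generic enumeration. The ordinals
-- β that reflect this relation, i.e. below which witnesses exist as soon as
-- they exist at all, form a club, and a generic enumeration of such a β is a
-- copy of β in which forcing equals truth. If Φ e maps β to α ≺ β and β′ to
-- α′ ≺ β′, then α ≺ α′ is impossible: some condition forces a rank α, by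
-- reflection there is one over β, and the order computed from a generic copy
-- of β extending it would be longer than α. So every functional has at most
-- one value shorter than its argument, and there is a countable bound κ for
-- these values. The antichain consists of the reflecting ordinals above κ
-- that are closed under β ↦ sup {α + 1 | α ≤ₛ β}.

module Submission where

open import Defs
open import Axiom.ExcludedMiddle using (ExcludedMiddle)
open import Data.Bool using (T; true; false)
open import Data.Empty using (⊥; ⊥-elim)
open import Data.Fin using (Fin; zero; suc; toℕ)
open import Data.Irrelevant using ([_])
open import Data.Maybe using (Maybe; just; nothing)
open import Data.Nat using (ℕ; zero; suc; _+_; z≤n; s≤s)
import Data.Nat as ℕ
import Data.Nat.Properties as ℕ
open import Data.Nat.Induction using (<-wellFounded)
open import Data.Product using (∃; _×_; _,_; proj₁; proj₂)
open import Data.Refinement using (Refinement; _,_; value; value-injective)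
open import Data.Sum using (_⊎_; inj₁; inj₂)
open import Data.Vec using (Vec; []; _∷_)
open import Function.Base using (_∘_; id)
open import Function.Bundles using (mk↣; Injection)
open import Induction.WellFounded using (Acc; acc; WellFounded)
open import Level using (0ℓ; _⊔_; lift; lower; Lift) renaming (suc to lsuc)
open import Relation.Binary.Core using (Rel)
import Relation.Binary.Construct.On as On
open import Relation.Binary.Definitions using (Trichotomous; Tri; tri<; tri≈; tri>; Transitive)
import Relation.Binary.Morphism.Construct.Composition as Composition
import Relation.Binary.Morphism.Construct.Identity as Identity
open import Relation.Binary.Morphism.Structures using (IsOrderIsomorphism)
open import Relation.Binary.PropositionalEquality
open import Relation.Binary.Structures using (IsStrictTotalOrder)
open import Relation.Nullary using (¬_; yes; no)
open import Relation.Nullary.Decidable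
  using (decidable-stable; fromWitness; isYes; map′; recompute; toWitness)
open import Relation.Unary using (Pred)

open ω₁ using (Carrier)

-- Oracle computations and codes

bit-injective : ∀ {a b} → bit a ≡ bit b → a ≡ b
bit-injective {false} {false} _ = refl
bit-injective {true}  {true}  _ = refl

⇓-deterministic : ∀ {B n} {p : Program n} {xs y z} →
                  B ⊢ p · xs ⇓ y → B ⊢ p · xs ⇓ z → y ≡ z
⇊-deterministic : ∀ {B m n} {ps : Vec (Program n) m} {xs ys zs} →
                  B ⊢ ps · xs ⇊ ys → B ⊢ ps · xs ⇊ zs → ys ≡ zs

⇓-deterministic zer⇓ zer⇓ = refl
⇓-deterministic succ⇓ succ⇓ = refl
⇓-deterministic ask⇓ ask⇓ = refl
⇓-deterministic proj⇓ proj⇓ = refl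
⇓-deterministic (comp⇓ qs p) (comp⇓ qs′ p′) with refl ← ⇊-deterministic qs qs′ =
  ⇓-deterministic p p′
⇓-deterministic (prec⇓₀ p) (prec⇓₀ p′) = ⇓-deterministic p p′
⇓-deterministic (prec⇓₁ p q) (prec⇓₁ p′ q′) with refl ← ⇓-deterministic p p′ =
  ⇓-deterministic q q′
⇓-deterministic (mu⇓ {y = y} before found) (mu⇓ {y = z} before′ found′) with ℕ.<-cmp y z
... | tri≈ _ y≡z _ = y≡z
-- At the smaller of the two results one search stops, on the value 0, while the other goes on, on a
-- successor.
... | tri< y<z _ _ with () ← ⇓-deterministic found (proj₂ (before′ y<z))
... | tri> _ _ z<y with () ← ⇓-deterministic (proj₂ (before z<y)) found′

⇊-deterministic [] [] = refl
⇊-deterministic (p ∷ ps) (p′ ∷ ps′) =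
  cong₂ _∷_ (⇓-deterministic p p′) (⇊-deterministic ps ps′)

AgreeBelow : ℕ → Subset → Subset → Set
AgreeBelow N B C = ∀ {n} → n ℕ.< N → B n ≡ C n

weaken : ∀ {M N B C} → M ℕ.≤ N → AgreeBelow N B C → AgreeBelow M B C
weaken M≤N agree n<M = agree (ℕ.<-≤-trans n<M M≤N)

-- Serves the `mu` case of continuity, where each of the finitely many rejected `k` comes with its
-- own bound on the oracle.
common-bound : (R : ℕ → ℕ → Set) → (∀ {k M N} → M ℕ.≤ N → R k M → R k N) →
               ∀ y → (∀ {k} → k ℕ.< y → ∃ (R k)) → ∃ λ N → ∀ {k} → k ℕ.< y → R k N
common-bound R mono zero    h = 0 , λ ()
common-bound R mono (suc y) h
  with M , below ← common-bound R mono y (λ k<y → h (ℕ.m<n⇒m<1+n k<y))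
     | N , at    ← h (ℕ.n<1+n y) = M ℕ.⊔ N , λ {k} k<1+y → bound (ℕ.m<1+n⇒m<n∨m≡n k<1+y)
  where
  bound : ∀ {k} → _ → R k (M ℕ.⊔ N)
  bound (inj₁ k<y)  = mono (ℕ.m≤m⊔n M N) (below k<y)
  bound (inj₂ refl) = mono (ℕ.m≤n⊔m M N) at

-- Use principle: a halting computation asks its oracle about finitely many numbers, and `N` exceeds
-- them all.
⇓-continuous : ∀ {B n} {p : Program n} {xs y} → B ⊢ p · xs ⇓ y →
      ∃ λ N → ∀ {C} → AgreeBelow N B C → C ⊢ p · xs ⇓ y
⇊-continuous : ∀ {B m n} {ps : Vec (Program n) m} {xs ys} → B ⊢ ps · xs ⇊ ys →
       ∃ λ N → ∀ {C} → AgreeBelow N B C → C ⊢ ps · xs ⇊ ys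

⇓-continuous zer⇓  = 0 , λ _ → zer⇓
⇓-continuous succ⇓ = 0 , λ _ → succ⇓
⇓-continuous {B} (ask⇓ {x}) = suc x , λ {C} agree →
  subst (λ b → C ⊢ ask · x ∷ [] ⇓ bit b) (sym (agree (ℕ.n<1+n x))) ask⇓
⇓-continuous proj⇓ = 0 , λ _ → proj⇓
⇓-continuous (comp⇓ qs p) with M , qs′ ← ⇊-continuous qs | N , p′ ← ⇓-continuous p =
  M ℕ.⊔ N , λ agree → comp⇓ (qs′ (weaken (ℕ.m≤m⊔n M N) agree)) (p′ (weaken (ℕ.m≤n⊔m M N) agree))
⇓-continuous (prec⇓₀ p) with N , p′ ← ⇓-continuous p = N , λ agree → prec⇓₀ (p′ agree)
⇓-continuous (prec⇓₁ p q) with M , p′ ← ⇓-continuous p | N , q′ ← ⇓-continuous q =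
  M ℕ.⊔ N , λ agree → prec⇓₁ (p′ (weaken (ℕ.m≤m⊔n M N) agree)) (q′ (weaken (ℕ.m≤n⊔m M N) agree))
⇓-continuous {B} (mu⇓ {p = p} {xs} {y} before found)
  with M , before′ ← common-bound
         (λ k N → ∃ λ v → ∀ {C} → AgreeBelow N B C → C ⊢ p · k ∷ xs ⇓ suc v)
         (λ M≤N (v , d) → v , λ agree → d (weaken M≤N agree)) y
         (λ k<y → proj₁ (⇓-continuous (proj₂ (before k<y))) , _ ,
                  proj₂ (⇓-continuous (proj₂ (before k<y))))
     | N , found′ ← ⇓-continuous found =
  M ℕ.⊔ N , λ agree → mu⇓
    (λ k<y → proj₁ (before′ k<y) , proj₂ (before′ k<y) (weaken (ℕ.m≤m⊔n M N) agree))
    (found′ (weaken (ℕ.m≤n⊔m M N) agree))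

⇊-continuous [] = 0 , λ _ → []
⇊-continuous (p ∷ ps) with M , p′ ← ⇓-continuous p | N , ps′ ← ⇊-continuous ps =
  M ℕ.⊔ N , λ agree → p′ (weaken (ℕ.m≤m⊔n M N) agree) ∷ ps′ (weaken (ℕ.m≤n⊔m M N) agree)

-- Inverting the pairing and coding programs

next : ℕ × ℕ → ℕ × ℕ
next (zero  , n) = suc n , 0
next (suc m , n) = m , suc n

⟨⟩-next : ∀ x → ⟨ proj₁ (next x) , proj₂ (next x) ⟩ ≡ suc ⟨ proj₁ x , proj₂ x ⟩
⟨⟩-next (zero , n) rewrite ℕ.+-identityʳ n | ℕ.+-identityʳ (n + triangle n) =
  cong suc (ℕ.+-comm n (triangle n))
⟨⟩-next (suc m , n) rewrite ℕ.+-suc m n = ℕ.+-suc _ n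

opaque
  unpair : ℕ → ℕ × ℕ
  unpair zero    = 0 , 0
  unpair (suc k) = next (unpair k)

  ⟨unpair⟩ : ∀ k → ⟨ proj₁ (unpair k) , proj₂ (unpair k) ⟩ ≡ k
  ⟨unpair⟩ zero    = refl
  ⟨unpair⟩ (suc k) = trans (⟨⟩-next (unpair k)) (cong suc (⟨unpair⟩ k))

  unpair-⟨⟩ : ∀ m n → unpair ⟨ m , n ⟩ ≡ (m , n)
  unpair-⟨⟩ m n = go (m + n) m n refl
    where
    -- Walks back through the codes: along the antidiagonal of sum `s` until the second entry is 0,
    -- then from `(suc m , 0)` to `(0 , m)`, the last pair of the previous antidiagonal.
    go : ∀ s m n → m + n ≡ s → unpair ⟨ m , n ⟩ ≡ (m , n)
    go _       zero    zero    _    = refl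
    go (suc s) (suc m) zero    eq   =
      trans (cong unpair (⟨⟩-next (0 , m)))
            (cong next (go s 0 m (trans (sym (ℕ.+-identityʳ m)) (ℕ.suc-injective eq))))
    go s       m       (suc n) eq   =
      trans (cong unpair (⟨⟩-next (suc m , n)))
            (cong next (go s (suc m) n (trans (sym (ℕ.+-suc m n)) eq)))

m≤⟨m,n⟩ : ∀ m n → m ℕ.≤ ⟨ m , n ⟩
m≤⟨m,n⟩ m n = ℕ.≤-trans (ℕ.≤-trans (ℕ.m≤m+n m n) (n≤triangle (m + n))) (ℕ.m≤m+n _ n)
  where
  n≤triangle : ∀ n → n ℕ.≤ triangle n
  n≤triangle zero    = z≤n
  n≤triangle (suc n) = ℕ.m≤m+n (suc n) _

n≤⟨m,n⟩ : ∀ m n → n ℕ.≤ ⟨ m , n ⟩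
n≤⟨m,n⟩ m n = ℕ.m≤n+m n _

-- Every natural number codes an infinite sequence, and every finite
-- sequence is an initial segment of a coded one.

_!_ : ℕ → ℕ → ℕ
c ! zero  = proj₁ (unpair c)
c ! suc i = proj₂ (unpair c) ! i

code : ℕ → (ℕ → ℕ) → ℕ
code zero    f = 0
code (suc n) f = ⟨ f 0 , code n (λ i → f (suc i)) ⟩

code-! : ∀ n f {i} → i ℕ.< n → code n f ! i ≡ f i
code-! (suc n) f {zero} _ rewrite unpair-⟨⟩ (f 0) (code n (λ i → f (suc i))) = refl
code-! (suc n) f {suc i} (s≤s i<n) rewrite unpair-⟨⟩ (f 0) (code n (λ i → f (suc i))) =
  code-! n (λ i → f (suc i)) i<n

-- Numbers out of range go to the last index, so that every number can code a projection.
fin : ∀ {n} → ℕ → Fin (suc n)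
fin         zero    = zero
fin {zero}  (suc k) = zero
fin {suc n} (suc k) = suc (fin k)

fin-toℕ : ∀ {n} (i : Fin (suc n)) → fin (toℕ i) ≡ i
fin-toℕ         zero    = refl
fin-toℕ {suc n} (suc i) = cong suc (fin-toℕ i)

-- program d n enumerates (with repetitions) the programs of arity n and
-- depth at most d; zer absorbs the numbers that code nothing.

program  : ℕ → ∀ n → ℕ → Program n
programs : ℕ → ∀ m n → ℕ → Vec (Program n) m
build    : ℕ → ℕ → ∀ n → (ℕ → ℕ) → Program n

program zero    n c = zer
program (suc d) n c = build d (c ! 0) n (λ i → c ! suc i)

build d 1 1             a = succ
build d 2 1             a = ask
build d 3 (suc n)       a = proj (fin (a 0))
build d 4 n             a = comp (program d (a 0) (a 1)) (programs d (a 0) n (a 2))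
build d 5 (suc n)       a = prec (program d n (a 0)) (program d (suc (suc n)) (a 1))
build d 6 n             a = mu (program d (suc n) (a 0))
build d _ n             a = zer

programs d zero    n c = []
programs d (suc m) n c = program d n (proj₁ (unpair c)) ∷ programs d m n (proj₂ (unpair c))


-- All depths from `d` on are allowed because the parts of a compound program have to be coded at
-- one common depth.
program-surjective  : ∀ {n} (p : Program n) →
                      ∃ λ d → ∀ {e} → d ℕ.≤ e → ∃ λ c → program e n c ≡ p
programs-surjective : ∀ {m n} (ps : Vec (Program n) m) →
                      ∃ λ d → ∀ {e} → d ℕ.≤ e → ∃ λ c → programs e m n c ≡ ps

program-surjective {n} zer = 1 , λ { (s≤s _) → ⟨ 0 , 0 ⟩ , eq _ }
  where
  eq : ∀ e → program (suc e) n ⟨ 0 , 0 ⟩ ≡ zer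
  eq e rewrite unpair-⟨⟩ 0 0 = refl
program-surjective succ = 1 , λ { (s≤s _) → ⟨ 1 , 0 ⟩ , eq _ }
  where
  eq : ∀ e → program (suc e) 1 ⟨ 1 , 0 ⟩ ≡ succ
  eq e rewrite unpair-⟨⟩ 1 0 = refl
program-surjective ask = 1 , λ { (s≤s _) → ⟨ 2 , 0 ⟩ , eq _ }
  where
  eq : ∀ e → program (suc e) 1 ⟨ 2 , 0 ⟩ ≡ ask
  eq e rewrite unpair-⟨⟩ 2 0 = refl
program-surjective (proj {suc n} i) = 1 , λ { (s≤s _) → ⟨ 3 , ⟨ toℕ i , 0 ⟩ ⟩ , eq _ }
  where
  eq : ∀ e → program (suc e) (suc n) ⟨ 3 , ⟨ toℕ i , 0 ⟩ ⟩ ≡ proj i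
  eq e rewrite unpair-⟨⟩ 3 ⟨ toℕ i , 0 ⟩ | unpair-⟨⟩ (toℕ i) 0 = cong proj (fin-toℕ i)
program-surjective {n} (comp {m} p qs)
  with d , p′ ← program-surjective p | d′ , qs′ ← programs-surjective qs =
  suc (d ℕ.⊔ d′) , λ { (s≤s le) →
    let x , p≡  = p′ (ℕ.≤-trans (ℕ.m≤m⊔n d d′) le)
        y , qs≡ = qs′ (ℕ.≤-trans (ℕ.m≤n⊔m d d′) le)
    in ⟨ 4 , ⟨ m , ⟨ x , ⟨ y , 0 ⟩ ⟩ ⟩ ⟩ , eq p≡ qs≡ }
  where
  eq : ∀ {e x y} → program e m x ≡ p → programs e m n y ≡ qs →
       program (suc e) n ⟨ 4 , ⟨ m , ⟨ x , ⟨ y , 0 ⟩ ⟩ ⟩ ⟩ ≡ comp p qs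
  eq {e} {x} {y} refl refl
    rewrite unpair-⟨⟩ 4 ⟨ m , ⟨ x , ⟨ y , 0 ⟩ ⟩ ⟩ | unpair-⟨⟩ m ⟨ x , ⟨ y , 0 ⟩ ⟩
          | unpair-⟨⟩ x ⟨ y , 0 ⟩ | unpair-⟨⟩ y 0 = refl
program-surjective {suc n} (prec p q)
  with d , p′ ← program-surjective p | d′ , q′ ← program-surjective q =
  suc (d ℕ.⊔ d′) , λ { (s≤s le) →
    let x , p≡ = p′ (ℕ.≤-trans (ℕ.m≤m⊔n d d′) le)
        y , q≡ = q′ (ℕ.≤-trans (ℕ.m≤n⊔m d d′) le)
    in ⟨ 5 , ⟨ x , ⟨ y , 0 ⟩ ⟩ ⟩ , eq p≡ q≡ }
  where
  eq : ∀ {e x y} → program e n x ≡ p → program e (suc (suc n)) y ≡ q →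
       program (suc e) (suc n) ⟨ 5 , ⟨ x , ⟨ y , 0 ⟩ ⟩ ⟩ ≡ prec p q
  eq {e} {x} {y} refl refl
    rewrite unpair-⟨⟩ 5 ⟨ x , ⟨ y , 0 ⟩ ⟩ | unpair-⟨⟩ x ⟨ y , 0 ⟩ | unpair-⟨⟩ y 0 = refl
program-surjective {n} (mu p) with d , p′ ← program-surjective p =
  suc d , λ { (s≤s le) → let x , p≡ = p′ le in ⟨ 6 , ⟨ x , 0 ⟩ ⟩ , eq p≡ }
  where
  eq : ∀ {e x} → program e (suc n) x ≡ p → program (suc e) n ⟨ 6 , ⟨ x , 0 ⟩ ⟩ ≡ mu p
  eq {e} {x} refl rewrite unpair-⟨⟩ 6 ⟨ x , 0 ⟩ | unpair-⟨⟩ x 0 = refl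

programs-surjective [] = 0 , λ _ → 0 , refl
programs-surjective {suc m} {n} (p ∷ ps)
  with d , p′ ← program-surjective p | d′ , ps′ ← programs-surjective ps =
  d ℕ.⊔ d′ , λ le →
    let x , p≡  = p′ (ℕ.≤-trans (ℕ.m≤m⊔n d d′) le)
        y , ps≡ = ps′ (ℕ.≤-trans (ℕ.m≤n⊔m d d′) le)
    in ⟨ x , y ⟩ , eq p≡ ps≡
  where
  eq : ∀ {e x y} → program e n x ≡ p → programs e m n y ≡ ps →
       programs e (suc m) n ⟨ x , y ⟩ ≡ p ∷ ps
  eq {e} {x} {y} refl refl rewrite unpair-⟨⟩ x y = refl

functional : ℕ → Program 1
functional c = program (proj₁ (unpair c)) 1 (proj₂ (unpair c))

functional-surjective : ∀ p → ∃ λ c → functional c ≡ p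
functional-surjective p with d , p′ ← program-surjective p with c , refl ← p′ ℕ.≤-refl =
  ⟨ d , c ⟩ , cong (λ x → program (proj₁ x) 1 (proj₂ x)) (unpair-⟨⟩ d c)

-- Countable well-orders

module _ {X Y : Set} {_<₁_ : Rel X 0ℓ} {_<₂_ : Rel Y 0ℓ} where

  mk≅ : (f : X → Y) → (∀ {x y} → f x ≡ f y → x ≡ y) → (∀ y → ∃ λ x → f x ≡ y) →
        (∀ {x y} → x <₁ y → f x <₂ f y) → (∀ {x y} → f x <₂ f y → x <₁ y) →
        Isomorphic _<₁_ _<₂_
  mk≅ f injective surjective mono cancel = f , record
    { isOrderMonomorphism = record
      { isOrderHomomorphism = record { cong = cong f ; mono = mono }
      ; injective = injective
      ; cancel    = cancel
      }
    ; surjective = λ y → proj₁ (surjective y) , λ { refl → proj₂ (surjective y) }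
    }

≅-sym : {X Y : Set} {_<₁_ : Rel X 0ℓ} {_<₂_ : Rel Y 0ℓ} →
        Isomorphic _<₁_ _<₂_ → Isomorphic _<₂_ _<₁_
≅-sym {X} {Y} {_<₁_} {_<₂_} (f , iso) = mk≅ g
    (λ {y} {z} eq → trans (sym (fg y)) (trans (cong f eq) (fg z)))
    (λ x → f x , injective (fg (f x)))
    (λ {y} {z} y<z → cancel (subst₂ _<₂_ (sym (fg y)) (sym (fg z)) y<z))
    (λ {y} {z} gy<gz → subst₂ _<₂_ (fg y) (fg z) (mono gy<gz))
    where
    open IsOrderIsomorphism iso hiding (cong)
    g : Y → X
    g y = proj₁ (surjective y)
    fg : ∀ y → f (g y) ≡ y
    fg y = proj₂ (surjective y) refl

≅-trans : {X Y Z : Set} {_<₁_ : Rel X 0ℓ} {_<₂_ : Rel Y 0ℓ} {_<₃_ : Rel Z 0ℓ} →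
          Isomorphic _<₁_ _<₂_ → Isomorphic _<₂_ _<₃_ → Isomorphic _<₁_ _<₃_
≅-trans (f , f-iso) (g , g-iso) = g ∘ f , Composition.isOrderIsomorphism trans f-iso g-iso

≅-refl : ∀ {α} → α ≅ α
≅-refl = id , Identity.isOrderIsomorphism _ _ refl

module Order (α : ω₁) where
  open IsStrictTotalOrder (ω₁.isStrictTotalOrder α) public using (trans; irrefl; compare; _<?_)

module _ (α β : ω₁) {f : Carrier α → Carrier β} where
  private
    module α = ω₁ α
    module β = ω₁ β

  mono-cancel : (∀ {x y} → x α.< y → f x β.< f y) → ∀ {x y} → f x β.< f y → x α.< y
  mono-cancel mono {x} {y} fx<fy with Order.compare α x y
  ... | tri< x<y _ _  = x<y
  ... | tri≈ _ refl _ = ⊥-elim (Order.irrefl β refl fx<fy)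
  ... | tri> _ _ y<x  = ⊥-elim (Order.irrefl β refl (Order.trans β fx<fy (mono y<x)))

  mono-injective : (∀ {x y} → x α.< y → f x β.< f y) → ∀ {x y} → f x ≡ f y → x ≡ y
  mono-injective mono {x} {y} fx≡fy with Order.compare α x y
  ... | tri< x<y _ _ = ⊥-elim (Order.irrefl β fx≡fy (mono x<y))
  ... | tri≈ _ x≡y _ = x≡y
  ... | tri> _ _ y<x = ⊥-elim (Order.irrefl β (sym fx≡fy) (mono y<x))

-- A point with `f x < x` would give `f (f x) < f x`, and so on down an infinite descending chain.
mono-progressive : ∀ α {f : Carrier α → Carrier α} →
                   (∀ {x y} → ω₁._<_ α x y → ω₁._<_ α (f x) (f y)) →
                   ∀ x → ¬ ω₁._<_ α (f x) x
mono-progressive α {f} mono x = go (ω₁.wellFounded α x)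
  where
  go : ∀ {x} → Acc (ω₁._<_ α) x → ¬ ω₁._<_ α (f x) x
  go (acc rs) fx<x = go (rs fx<x) (mono fx<x)

≺-trans : ∀ {α β γ} → α ≺ β → β ≺ γ → α ≺ γ
≺-trans {α} {β} {γ} p q = record
  { bound = q.embed p.bound
  ; embed = q.embed ∘ p.embed
  ; mono  = q.mono ∘ p.mono
  ; below = q.mono ∘ p.below
  ; onto  = onto
  }
  where
  module p = _≺_ p
  module q = _≺_ q
  onto : ∀ {z} → ω₁._<_ γ z (q.embed p.bound) → ∃ λ x → q.embed (p.embed x) ≡ z
  onto z<b with q.onto (Order.trans γ z<b (q.below p.bound))
  ... | y , refl with p.onto (mono-cancel β γ q.mono z<b)
  ...   | x , refl = x , refl

-- Below α, a descending chain of ordinals is mirrored by the bounds of its members in α, which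
-- descend in a well-founded order.
≺-wellFounded : WellFounded _≺_
≺-wellFounded α = acc λ γ≺α → go γ≺α (ω₁.wellFounded α (_≺_.bound γ≺α))
  where
  go : ∀ {γ} (γ≺α : γ ≺ α) → Acc (ω₁._<_ α) (_≺_.bound γ≺α) → Acc _≺_ γ
  go γ≺α (acc rs) = acc λ δ≺γ → go (≺-trans δ≺γ γ≺α) (rs (_≺_.below γ≺α (_≺_.bound δ≺γ)))

≅-≺ : ∀ {α β γ} → α ≅ β → β ≺ γ → α ≺ γ
≅-≺ {α} {β} {γ} (f , iso) β≺γ = record
  { bound = p.bound
  ; embed = p.embed ∘ f
  ; mono  = p.mono ∘ f.mono
  ; below = p.below ∘ f
  ; onto  = onto
  }
  where
  module f = IsOrderIsomorphism iso
  module p = _≺_ β≺γ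
  onto : ∀ {z} → ω₁._<_ γ z p.bound → ∃ λ x → p.embed (f x) ≡ z
  onto z<b with y , refl ← p.onto z<b =
    proj₁ (f.surjective y) , cong p.embed (proj₂ (f.surjective y) refl)

≺-≅ : ∀ {α β γ} → α ≺ β → β ≅ γ → α ≺ γ
≺-≅ {α} {β} {γ} α≺β (f , iso) = record
  { bound = f p.bound
  ; embed = f ∘ p.embed
  ; mono  = f.mono ∘ p.mono
  ; below = f.mono ∘ p.below
  ; onto  = onto
  }
  where
  module f = IsOrderIsomorphism iso
  module p = _≺_ α≺β
  onto : ∀ {z} → ω₁._<_ γ z (f p.bound) → ∃ λ x → f (p.embed x) ≡ z
  onto {z} z<b with y , fy≡ ← f.surjective z with refl ← fy≡ refl
    with x , refl ← p.onto (f.cancel z<b) = x , refl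

-- The self-map `f ∘ g` of β would be monotone and move `b` below itself.
bounded-embedding⇒¬≽ : ∀ {α β b} {f : Carrier α → Carrier β} {g : Carrier β → Carrier α} →
  (∀ {x y} → ω₁._<_ α x y → ω₁._<_ β (f x) (f y)) → (∀ x → ω₁._<_ β (f x) b) →
  (∀ {x y} → ω₁._<_ β x y → ω₁._<_ α (g x) (g y)) → ⊥
bounded-embedding⇒¬≽ {β = β} {b} f-mono f<b g-mono =
  mono-progressive β (f-mono ∘ g-mono) b (f<b _)

≺⇒≇ : ∀ {α β} → α ≺ β → ¬ α ≅ β
≺⇒≇ {α} {β} p α≅β = bounded-embedding⇒¬≽ {α} {β} (_≺_.mono p) (_≺_.below p)
  (IsOrderIsomorphism.mono (proj₂ (≅-sym α≅β)))

≺-irrefl : ∀ {α} → ¬ α ≺ α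
≺-irrefl {α} p = ≺⇒≇ p (≅-refl {α})

≺-asym : ∀ {α β} → α ≺ β → ¬ β ≺ α
≺-asym p q = ≺-irrefl (≺-trans p q)

-- The proofs of y < x are irrelevant, so that the elements of the initial
-- segment are propositionally equal as soon as they are in α.

seg : (α : ω₁) → Carrier α → ω₁
seg α x = record
  { Carrier = Refinement (Carrier α) (λ y → ω₁._<_ α y x)
  ; _<_ = λ u v → ω₁._<_ α (value u) (value v)
  ; isStrictTotalOrder = record
    { isStrictPartialOrder = record
      { isEquivalence = isEquivalence
      ; irrefl = λ { refl → Order.irrefl α refl }
      ; trans = Order.trans α
      ; <-resp-≈ = (λ { refl → id }) , (λ { refl → id })
      }
    ; compare = λ u v → compare-values u v (Order.compare α (value u) (value v))
    }
  ; wellFounded = On.wellFounded value (ω₁.wellFounded α)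
  ; countable = mk↣ (value-injective ∘ Injection.injective (ω₁.countable α))
  }
  where
  compare-values : ∀ (u v : Refinement (Carrier α) _) →
    Tri (ω₁._<_ α (value u) (value v)) (value u ≡ value v) (ω₁._<_ α (value v) (value u)) →
    Tri (ω₁._<_ α (value u) (value v)) (u ≡ v) (ω₁._<_ α (value v) (value u))
  compare-values u v (tri< a b c) = tri< a (b ∘ cong value) c
  compare-values u v (tri≈ a b c) = tri≈ a (value-injective b) c
  compare-values u v (tri> a b c) = tri> a (b ∘ cong value) c

seg-≺ : ∀ α x → seg α x ≺ α
seg-≺ α x = record
  { bound = x
  ; embed = value
  ; mono  = id
  ; below = λ { (y , [ y<x ]) → recompute (Order._<?_ α y x) y<x }
  ; onto  = λ {y} y<x → (y , [ y<x ]) , refl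
  }

≺⇒≅seg : ∀ {α β} (p : α ≺ β) → α ≅ seg β (_≺_.bound p)
≺⇒≅seg {α} {β} p = mk≅ (λ x → embed x , [ below x ])
  (mono-injective α β mono ∘ cong value)
  (λ { (y , [ y<b ]) → let x , eq = onto (recompute (Order._<?_ β y bound) y<b)
                       in x , value-injective eq })
  mono (mono-cancel α β mono)
  where open _≺_ p

seg-mono : ∀ α {x y} → ω₁._<_ α x y → seg α x ≺ seg α y
seg-mono α {x} {y} x<y = record
  { bound = x , [ x<y ]
  ; embed = λ { (z , [ z<x ]) → z , [ Order.trans α z<x x<y ] }
  ; mono  = id
  ; below = λ { (z , [ z<x ]) → recompute (Order._<?_ α z x) z<x }
  ; onto  = λ { {z , _} z<x → (z , [ z<x ]) , refl }
  }

-- Together with the next three lemmas this identifies the ordinals below γ, up to `≅`, with the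
-- elements of γ. It turns an enumeration of ordinals below γ into one of the elements of γ.
bound-reflects-< : ∀ {α β γ} (p : α ≺ γ) (q : β ≺ γ) →
                   ω₁._<_ γ (_≺_.bound p) (_≺_.bound q) → α ≺ β
bound-reflects-< {γ = γ} p q b<c =
  ≅-≺ (≺⇒≅seg p) (≺-≅ (seg-mono γ b<c) (≅-sym (≺⇒≅seg q)))

bound-reflects-≡ : ∀ {α β γ} (p : α ≺ γ) (q : β ≺ γ) → _≺_.bound p ≡ _≺_.bound q → α ≅ β
bound-reflects-≡ {β = β} {γ} p q b≡c =
  ≅-trans (≺⇒≅seg p) (≅-sym (subst (λ b → β ≅ seg γ b) (sym b≡c) (≺⇒≅seg q)))

module _ {α β γ} (p : α ≺ γ) (q : β ≺ γ) where

  bound-mono : α ≺ β → ω₁._<_ γ (_≺_.bound p) (_≺_.bound q)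
  bound-mono α≺β with Order.compare γ (_≺_.bound p) (_≺_.bound q)
  ... | tri< b<c _ _ = b<c
  ... | tri≈ _ b≡c _ = ⊥-elim (≺⇒≇ α≺β (bound-reflects-≡ p q b≡c))
  ... | tri> _ _ c<b = ⊥-elim (≺-asym α≺β (bound-reflects-< q p c<b))

  bound-cong : α ≅ β → _≺_.bound p ≡ _≺_.bound q
  bound-cong α≅β with Order.compare γ (_≺_.bound p) (_≺_.bound q)
  ... | tri< b<c _ _ = ⊥-elim (≺⇒≇ (bound-reflects-< p q b<c) α≅β)
  ... | tri≈ _ b≡c _ = b≡c
  ... | tri> _ _ c<b = ⊥-elim (≺⇒≇ (bound-reflects-< q p c<b) (≅-sym α≅β))

-- Bisimilarity, an inductive substitute for isomorphism of the segments below `x` and `y`. It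
-- matches two well-orders element by element before either is known to embed in the other.
data SameRank (α β : ω₁) (x : Carrier α) (y : Carrier β) : Set where
  same : (∀ {x′} → ω₁._<_ α x′ x → ∃ λ y′ → ω₁._<_ β y′ y × SameRank α β x′ y′) →
         (∀ {y′} → ω₁._<_ β y′ y → ∃ λ x′ → ω₁._<_ α x′ x × SameRank α β x′ y′) →
         SameRank α β x y

SameRank-sym : ∀ {α β x y} → SameRank α β x y → SameRank β α y x
SameRank-sym (same f g) = same
  (λ lt → proj₁ (g lt) , proj₁ (proj₂ (g lt)) , SameRank-sym (proj₂ (proj₂ (g lt))))
  (λ lt → proj₁ (f lt) , proj₁ (proj₂ (f lt)) , SameRank-sym (proj₂ (proj₂ (f lt))))

-- Suppose `x` matches both `y` and `z` with `y < z`. Then `y`, lying below `z`, matches some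
-- `x′ < x`, which also matches some `y′ < y`. Induction at `x′` gives `y′ ≡ y`, which is absurd.
SameRank-functional : ∀ {α β x y z} → SameRank α β x y → SameRank α β x z → y ≡ z
SameRank-functional {α} {β} = go (ω₁.wellFounded α _)
  where
  ≮ : ∀ {x y z} → Acc (ω₁._<_ α) x → SameRank α β x y → SameRank α β x z → ¬ ω₁._<_ β y z
  go : ∀ {x y z} → Acc (ω₁._<_ α) x → SameRank α β x y → SameRank α β x z → y ≡ z
  ≮ (acc rs) (same f _) (same _ g) y<z
    with x′ , x′<x , x′~y ← g y<z with y′ , y′<y , x′~y′ ← f x′<x =
    Order.irrefl β (go (rs x′<x) x′~y′ x′~y) y′<y
  go {y = y} {z} a x~y x~z with Order.compare β y z
  ... | tri< y<z _ _ = ⊥-elim (≮ a x~y x~z y<z)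
  ... | tri≈ _ y≡z _ = y≡z
  ... | tri> _ _ z<y = ⊥-elim (≮ a x~z x~y z<y)

SameRank-mono : ∀ {α β x x′ y y′} → SameRank α β x y → SameRank α β x′ y′ →
                ω₁._<_ α x x′ → ω₁._<_ β y y′
SameRank-mono x~y (same f _) x<x′ with z , z<y′ , x~z ← f x<x′
  with refl ← SameRank-functional x~y x~z = z<y′

Unmatched : (α β : ω₁) → Carrier α → Set
Unmatched α β x = ¬ ∃ (SameRank α β x)

-- Matched elements form an initial segment, so none of them lies at or above an unmatched one.
below-unmatched : ∀ {α β b x y} → Unmatched β α b → SameRank α β x y → ω₁._<_ β y b
below-unmatched {α} {β} {b} {x} {y} unmatched x~y@(same _ h) with Order.compare β y b
... | tri< y<b _ _  = y<b
... | tri≈ _ refl _ = ⊥-elim (unmatched (x , SameRank-sym x~y))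
... | tri> _ _ b<y  with x′ , _ , x′~b ← h b<y = ⊥-elim (unmatched (x′ , SameRank-sym x′~b))

SameRank-total⇒≅ : ∀ {α β} → (∀ x → ∃ (SameRank α β x)) → (∀ y → ∃ (SameRank β α y)) → α ≅ β
SameRank-total⇒≅ {α} {β} f g = mk≅ (proj₁ ∘ f)
  (mono-injective α β mono)
  (λ y → proj₁ (g y) , SameRank-functional (proj₂ (f _)) (SameRank-sym (proj₂ (g y))))
  mono (mono-cancel α β mono)
  where
  mono : ∀ {x y} → ω₁._<_ α x y → ω₁._<_ β (proj₁ (f x)) (proj₁ (f y))
  mono = SameRank-mono (proj₂ (f _)) (proj₂ (f _))

SameRank-gap⇒≺ : ∀ {α β b} → (∀ x → ∃ (SameRank α β x)) → Unmatched β α b →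
                 (∀ {y} → ω₁._<_ β y b → ∃ (SameRank β α y)) → α ≺ β
SameRank-gap⇒≺ {b = b} f unmatched matched = record
  { bound = b
  ; embed = proj₁ ∘ f
  ; mono  = SameRank-mono (proj₂ (f _)) (proj₂ (f _))
  ; below = λ x → below-unmatched unmatched (proj₂ (f x))
  ; onto  = λ y<b → proj₁ (matched y<b) ,
                    SameRank-functional (proj₂ (f _)) (SameRank-sym (proj₂ (matched y<b)))
  }

data Sum< (f : ℕ → ω₁) : Rel (∃ λ n → Maybe (Carrier (f n))) 0ℓ where
  earlier : ∀ {m n x y} → m ℕ.< n → Sum< f (m , x) (n , y)
  just< : ∀ {n x y} → ω₁._<_ (f n) x y → Sum< f (n , just x) (n , just y)
  top   : ∀ {n x} → Sum< f (n , just x) (n , nothing)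

-- The summands are the ordinals f n + 1, so that each f n lies strictly
-- below the sum.

sum : (ℕ → ω₁) → ω₁
sum f = record
  { Carrier = ∃ λ n → Maybe (Carrier (f n))
  ; _<_ = Sum< f
  ; isStrictTotalOrder = record
    { isStrictPartialOrder = record
      { isEquivalence = isEquivalence
      ; irrefl = λ { refl → irreflexive }
      ; trans = transitive
      ; <-resp-≈ = (λ { refl → id }) , (λ { refl → id })
      }
    ; compare = compare
    }
  ; wellFounded = λ (n , _) → accessible (<-wellFounded n) _
  ; countable = mk↣ injective
  }
  where
  irreflexive : ∀ {u} → ¬ Sum< f u u
  irreflexive (earlier n<n) = ℕ.<-irrefl refl n<n
  irreflexive {n , _} (just< x<x) = Order.irrefl (f n) refl x<x

  transitive : Transitive (Sum< f)
  transitive (earlier p) (earlier q) = earlier (ℕ.<-trans p q)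
  transitive (earlier p) (just< _) = earlier p
  transitive (earlier p) top       = earlier p
  transitive (just< _) (earlier q) = earlier q
  transitive {n , _} (just< p) (just< q) = just< (Order.trans (f n) p q)
  transitive (just< _) top       = top
  transitive top       (earlier q) = earlier q

  below : ∀ {u v} → Sum< f u v → Tri (Sum< f u v) (u ≡ v) (Sum< f v u)
  below u<v = tri< u<v (λ { refl → irreflexive u<v }) (irreflexive ∘ transitive u<v)

  above : ∀ {u v} → Sum< f v u → Tri (Sum< f u v) (u ≡ v) (Sum< f v u)
  above v<u = tri> (irreflexive ∘ transitive v<u) (λ { refl → irreflexive v<u }) v<u

  compare : Trichotomous _≡_ (Sum< f)
  compare (m , x) (n , y) with ℕ.<-cmp m n
  ... | tri< m<n _ _ = below (earlier m<n)
  ... | tri> _ _ n<m = above (earlier n<m)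
  compare (n , nothing) (n , nothing) | tri≈ _ refl _ = tri≈ irreflexive refl irreflexive
  compare (n , just x)  (n , nothing) | tri≈ _ refl _ = below top
  compare (n , nothing) (n , just y)  | tri≈ _ refl _ = above top
  compare (n , just x)  (n , just y)  | tri≈ _ refl _ with Order.compare (f n) x y
  ... | tri< x<y _ _  = below (just< x<y)
  ... | tri≈ _ refl _ = tri≈ irreflexive refl irreflexive
  ... | tri> _ _ y<x  = above (just< y<x)

  accessible : ∀ {n} → Acc ℕ._<_ n → ∀ x → Acc (Sum< f) (n , x)
  accessible {n} (acc rs) = λ { (just x) → just-acc (ω₁.wellFounded (f n) x) ; nothing → top-acc }
    where
    just-acc : ∀ {x} → Acc (ω₁._<_ (f n)) x → Acc (Sum< f) (n , just x)
    just-acc (acc rs′) = acc λ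
      { (earlier m<n) → accessible (rs m<n) _
      ; (just< y<x)   → just-acc (rs′ y<x)
      }
    top-acc : Acc (Sum< f) (n , nothing)
    top-acc = acc λ
      { (earlier m<n) → accessible (rs m<n) _
      ; top           → just-acc (ω₁.wellFounded (f n) _)
      }

  ι : ∀ {n} → Maybe (Carrier (f n)) → ℕ
  ι     nothing  = 0
  ι {n} (just x) = suc (Injection.to (ω₁.countable (f n)) x)

  ι-injective : ∀ {n} (x y : Maybe (Carrier (f n))) → ι x ≡ ι y → x ≡ y
  ι-injective     nothing  nothing  _  = refl
  ι-injective {n} (just x) (just y) eq =
    cong just (Injection.injective (ω₁.countable (f n)) (ℕ.suc-injective eq))

  injective : ∀ {u v : ∃ λ n → Maybe (Carrier (f n))} →
              ⟨ proj₁ u , ι (proj₂ u) ⟩ ≡ ⟨ proj₁ v , ι (proj₂ v) ⟩ → u ≡ v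
  injective {m , x} {n , y} eq
    with trans (sym (unpair-⟨⟩ m (ι x))) (trans (cong unpair eq) (unpair-⟨⟩ n (ι y)))
  ... | eq′ with refl ← cong proj₁ eq′ = cong (m ,_) (ι-injective x y (cong proj₂ eq′))

minimal : ∀ {a b} → ExcludedMiddle (a ⊔ b) →
          {X : Set a} {_<_ : Rel X 0ℓ} → WellFounded _<_ → (P : X → Set b) → ∃ P →
          ∃ λ x → P x × (∀ {y} → y < x → ¬ P y)
minimal em {X} {_<_} wf P (x , Px) = decidable-stable em λ none → go none (wf x) Px
  where
  go : ¬ (∃ λ x → P x × (∀ {y} → y < x → ¬ P y)) → ∀ {x} → Acc _<_ x → ¬ P x
  go none (acc rs) Px = none (_ , Px , λ y<x → go none (rs y<x))

-- Comparability and suprema by excluded middle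

module Classical (em : ExcludedMiddle (lsuc 0ℓ)) where

  em₀ : ExcludedMiddle 0ℓ
  em₀ {P} = map′ lower lift (em {P = Lift (lsuc 0ℓ) P})

  match : ∀ α β → (∀ x → ∃ (SameRank α β x)) ⊎
                  (∃ λ a → Unmatched α β a × (∀ {x} → ω₁._<_ α x a → ∃ (SameRank α β x)))
  match α β with em₀ {∃ (Unmatched α β)}
  ... | no ¬u = inj₁ λ x → decidable-stable em₀ (¬u ∘ (x ,_))
  ... | yes u with a , unmatched , least ← minimal em₀ (ω₁.wellFounded α) (Unmatched α β) u =
    inj₂ (a , unmatched , decidable-stable em₀ ∘ least)

  ≺-compare : ∀ α β → α ≺ β ⊎ α ≅ β ⊎ β ≺ α
  ≺-compare α β with match α β | match β α
  ... | inj₁ f | inj₁ g             = inj₂ (inj₁ (SameRank-total⇒≅ f g))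
  ... | inj₁ f | inj₂ (_ , ub , mb) = inj₁ (SameRank-gap⇒≺ f ub mb)
  ... | inj₂ (_ , ua , ma) | inj₁ g = inj₂ (inj₂ (SameRank-gap⇒≺ g ua ma))
  -- Everything below the two least unmatched elements is matched, so they match each other after
  -- all.
  ... | inj₂ (_ , ua , ma) | inj₂ (_ , ub , mb) = ⊥-elim (ua (_ , same
    (λ x<a → let y , x~y = ma x<a in y , below-unmatched ub x~y , x~y)
    (λ y<b → let x , y~x = mb y<b in x , below-unmatched ua y~x , SameRank-sym y~x)))

  infix 4 _≼_
  _≼_ : Rel ω₁ 0ℓ
  α ≼ β = ¬ β ≺ α

  ≅⇒≼ : ∀ {α β} → α ≅ β → α ≼ β
  ≅⇒≼ α≅β β≺α = ≺⇒≇ β≺α (≅-sym α≅β)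

  ≺-≼-trans : ∀ {α β γ} → α ≺ β → β ≼ γ → α ≺ γ
  ≺-≼-trans {β = β} {γ} α≺β β≼γ with ≺-compare β γ
  ... | inj₁ β≺γ        = ≺-trans α≺β β≺γ
  ... | inj₂ (inj₁ β≅γ) = ≺-≅ α≺β β≅γ
  ... | inj₂ (inj₂ γ≺β) = ⊥-elim (β≼γ γ≺β)

  ≼-≺-trans : ∀ {α β γ} → α ≼ β → β ≺ γ → α ≺ γ
  ≼-≺-trans {α} {β} α≼β β≺γ with ≺-compare α β
  ... | inj₁ α≺β        = ≺-trans α≺β β≺γ
  ... | inj₂ (inj₁ α≅β) = ≅-≺ α≅β β≺γ
  ... | inj₂ (inj₂ β≺α) = ⊥-elim (α≼β β≺α)

  -- The range of `f` may have gaps, so `f` is not itself the required embedding. Instead, either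
  -- other outcome of the comparison would supply a monotone map back from β to α.
  bounded-embedding⇒≺ : ∀ {α β b} {f : Carrier α → Carrier β} →
    (∀ {x y} → ω₁._<_ α x y → ω₁._<_ β (f x) (f y)) → (∀ x → ω₁._<_ β (f x) b) → α ≺ β
  bounded-embedding⇒≺ {α} {β} f-mono f<b with ≺-compare α β
  ... | inj₁ α≺β        = α≺β
  ... | inj₂ (inj₁ α≅β) = ⊥-elim (bounded-embedding⇒¬≽ {α} {β} f-mono f<b
                            (IsOrderIsomorphism.mono (proj₂ (≅-sym α≅β))))
  ... | inj₂ (inj₂ β≺α) = ⊥-elim (bounded-embedding⇒¬≽ {α} {β} f-mono f<b (_≺_.mono β≺α))

  ≺-sum : ∀ f n → f n ≺ sum f
  ≺-sum f n = bounded-embedding⇒≺ {f n} {sum f} just< (λ _ → top {n = n})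

  -- `sum f` is a strict upper bound but may overshoot. The least one exists by well-foundedness,
  -- and its minimality is what makes the sequence cofinal.
  least-upper-bound : (f : ℕ → ω₁) → ∃ λ σ → (∀ n → f n ≺ σ) × (∀ {γ} → γ ≺ σ → ∃ λ n → γ ≼ f n)
  least-upper-bound f
    with σ , f≺σ , least ← minimal em ≺-wellFounded (λ σ → Lift (lsuc 0ℓ) (∀ n → f n ≺ σ))
                             (sum f , lift (≺-sum f)) =
    σ , lower f≺σ , λ {γ} γ≺σ → decidable-stable em₀ λ none →
      least γ≺σ (lift λ n → decidable-stable em₀ λ f⊀γ → none (n , f⊀γ))

  -- Not the maximum itself, but an ordinal strictly above both.
  max : ω₁ → ω₁ → ω₁
  max α β = sum λ { zero → α ; (suc _) → β }

  ≺-maxˡ : ∀ α β → α ≺ max α β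
  ≺-maxˡ α β = ≺-sum _ 0

  ≺-maxʳ : ∀ α β → β ≺ max α β
  ≺-maxʳ α β = ≺-sum _ 1

-- Forcing with finite partial enumerations of ordinals

-- Only the values val i for i < len carry information.

record Condition : Set₁ where
  constructor condition
  field
    len : ℕ
    val : ℕ → ω₁

open Condition

infix 4 _⊑_

record _⊑_ (q p : Condition) : Set where
  constructor extends
  field
    longer : len p ℕ.≤ len q
    agree  : ∀ {i} → i ℕ.< len p → val q i ≅ val p i

open _⊑_

⊑-refl : ∀ {p} → p ⊑ p
⊑-refl {p} = extends ℕ.≤-refl λ {i} _ → ≅-refl {val p i}

⊑-trans : ∀ {p q r} → r ⊑ q → q ⊑ p → r ⊑ p
⊑-trans r⊑q q⊑p = extends (ℕ.≤-trans (longer q⊑p) (longer r⊑q))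
  λ i< → ≅-trans (agree r⊑q (ℕ.<-≤-trans i< (longer q⊑p))) (agree q⊑p i<)

Valid : Condition → Set
Valid p = ∀ {i j} → i ℕ.< len p → j ℕ.< len p → val p i ≅ val p j → i ≡ j

Inside : ω₁ → Condition → Set
Inside δ p = ∀ {i} → i ℕ.< len p → val p i ≺ δ

Agrees : Subset → Condition → Set
Agrees B p = ∀ {i j} → i ℕ.< len p → j ℕ.< len p →
             (diagram B i j → val p i ≺ val p j) × (val p i ≺ val p j → diagram B i j)

Agrees-mono : ∀ {B p q} → q ⊑ p → Agrees B q → Agrees B p
Agrees-mono {q = q} q⊑p agrees i< j<
  with to , from ← agrees (ℕ.<-≤-trans i< (longer q⊑p)) (ℕ.<-≤-trans j< (longer q⊑p)) =
  (λ d → ≅-≺ (≅-sym (agree q⊑p i<)) (≺-≅ (to d) (agree q⊑p j<))) ,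
  (λ lt → from (≅-≺ (agree q⊑p i<) (≺-≅ lt (≅-sym (agree q⊑p j<)))))

-- Only the finite part of the oracle fixed by `p` counts: every oracle with that part, whether or
-- not it is a copy of an ordinal, must lead to the answer 1.
Forces : Program 1 → ℕ → ℕ → Condition → Set
Forces e k m p = ∀ {B} → Agrees B p → B ⊢ e · ⟨ k , m ⟩ ∷ [] ⇓ 1

-- p ⊩ "m has rank at least ξ in the order computed by Φ e", unfolded: the
-- conditions forcing some k < m of rank at least η are dense below p for
-- every η < ξ. All ordinals, not just those below some β, are allowed as
-- values of the conditions.

data RankAtLeast (e : Program 1) (ξ : ω₁) (m : ℕ) (p : Condition) : Set₁ where
  rank≥ : (∀ {η} → η ≺ ξ → ∀ {q} → q ⊑ p → Valid q →
           ∃ λ r → r ⊑ q × Valid r × ∃ λ k → Forces e k m r × RankAtLeast e η k r) →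
          RankAtLeast e ξ m p

RankAbove : Program 1 → ω₁ → ℕ → Condition → Set₁
RankAbove e η m p = ∃ λ k → Forces e k m p × RankAtLeast e η k p

-- `RankAbove` means that the condition has settled on a witness at level η. Here some level η ≺ ξ
-- admits no witness anywhere below `p`, a strong negation of `RankAtLeast`.
Blocked : Program 1 → ω₁ → ℕ → Condition → Set₁
Blocked e ξ m p = ∃ λ η → η ≺ ξ × (∀ {r} → r ⊑ p → Valid r → ¬ RankAbove e η m r)

-- The three predicates that a generic enumeration has to decide, numbered
-- so that they can be coded together with their parameters.

Property : ℕ → Program 1 → ω₁ → ℕ → Condition → Set₁
Property 0 = RankAtLeast
Property 1 = RankAbove
Property _ = Blocked

RankAtLeast-mono : ∀ {e ξ m p q} → q ⊑ p → RankAtLeast e ξ m p → RankAtLeast e ξ m q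
RankAtLeast-mono q⊑p (rank≥ f) = rank≥ λ η≺ξ r⊑q → f η≺ξ (⊑-trans r⊑q q⊑p)

RankAtLeast-cong : ∀ {e ξ ξ′ m p} → ξ ≅ ξ′ → RankAtLeast e ξ m p → RankAtLeast e ξ′ m p
RankAtLeast-cong ξ≅ξ′ (rank≥ f) = rank≥ λ η≺ξ′ → f (≺-≅ η≺ξ′ (≅-sym ξ≅ξ′))

Property-mono : ∀ t {e ξ m p q} → q ⊑ p → Property t e ξ m p → Property t e ξ m q
Property-mono 0 q⊑p x = RankAtLeast-mono q⊑p x
Property-mono 1 q⊑p (k , k<m , x) = k , (λ {B} → k<m ∘ Agrees-mono {B} q⊑p) , RankAtLeast-mono q⊑p x
Property-mono (suc (suc _)) q⊑p (η , η≺ξ , none) = η , η≺ξ , λ r⊑q → none (⊑-trans r⊑q q⊑p)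

Property-cong : ∀ t {e ξ ξ′ m p} → ξ ≅ ξ′ → Property t e ξ m p → Property t e ξ′ m p
Property-cong 0 ξ≅ξ′ x = RankAtLeast-cong ξ≅ξ′ x
Property-cong 1 ξ≅ξ′ (k , k<m , x) = k , k<m , RankAtLeast-cong ξ≅ξ′ x
Property-cong (suc (suc _)) ξ≅ξ′ (η , η≺ξ , none) = η , ≺-≅ η≺ξ ξ≅ξ′ , none

infix 4 _∣_↦_

record _∣_↦_ (e : Program 1) (β α : ω₁) : Set where
  constructor uniformly
  field
    compute : ∀ B → B IsCopyOf (ω₁._<_ β) → ∃ λ D → Φ e , B ≐ D × D IsCopyOf (ω₁._<_ α)

open _∣_↦_

-- Fails for finite ordinals, since copies have domain ω.
HasCopy : ω₁ → Set
HasCopy β = ∃ λ B → B IsCopyOf (ω₁._<_ β)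

↦-cong : ∀ {e α β β′} → β ≅ β′ → e ∣ β ↦ α → e ∣ β′ ↦ α
↦-cong β≅β′ e↦ = uniformly λ B copy → compute e↦ B (≅-trans copy (≅-sym β≅β′))

-- On one and the same copy of β, determinism makes the two computed diagrams equal.
↦-unique : ∀ {e α α′ β} → HasCopy β → e ∣ β ↦ α → e ∣ β ↦ α′ → α ≅ α′
↦-unique (B , copy) f g
  with D , ΦD , D-copy ← compute f B copy | E , ΦE , E-copy ← compute g B copy =
  ≅-trans (≅-sym D-copy) (≅-trans D≅E E-copy)
  where
  D≡E : ∀ n → D n ≡ E n
  D≡E n = bit-injective (⇓-deterministic (ΦD n) (ΦE n))
  D≅E : Isomorphic (diagram D) (diagram E)
  D≅E = mk≅ id id (λ y → y , refl) (subst T (D≡E _)) (subst T (sym (D≡E _)))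

-- Reflection of the forcing relation to countable ordinals

module Bounding (em : ExcludedMiddle (lsuc 0ℓ)) where
  open Classical em

  -- The closure points of `W`. Demanding an element excludes 0, where the second clause is vacuous.
  Closed : (ω₁ → ω₁ → Set₁) → Pred ω₁ (lsuc 0ℓ)
  Closed W β = Carrier β × (∀ {γ} → γ ≺ β → ∃ λ δ → δ ≺ β × W γ δ)

  module _ {W : ω₁ → ω₁ → Set₁}
           (total : ∀ γ → ∃ (W γ))
           (antitone : ∀ {γ γ′ δ} → γ ≼ γ′ → W γ′ δ → W γ δ) where

    -- For unboundedness, `W` is iterated ω times from α and the supremum taken. Any γ below it is
    -- at most some iterate, whose successor in the iteration then also serves γ by antitonicity.
    Closed-isClub : IsClub (Closed W)
    Closed-isClub = record
      { respects  = λ { {α} {β} α≅β (x , closed) → proj₁ α≅β x , λ γ≺β →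
                      let δ , δ≺α , w = closed (≺-≅ γ≺β (≅-sym α≅β)) in δ , ≺-≅ δ≺α α≅β , w }
      ; closed    = λ (x , _) unbounded → x , λ γ≺δ →
                      let β , (_ , closed) , γ≺β , β≺δ = unbounded γ≺δ
                          ε , ε≺β , w = closed γ≺β
                      in ε , ≺-trans ε≺β β≺δ , w
      ; unbounded = unbounded
      }
      where
      iterate : ω₁ → ℕ → ω₁
      iterate α zero    = α
      iterate α (suc n) = proj₁ (total (iterate α n))

      unbounded : ∀ α → ∃ λ β → Closed W β × α ≺ β
      unbounded α with β , iterates≺β , cofinal ← least-upper-bound (iterate α) =
        β , (_≺_.bound (iterates≺β 0) , closed) , iterates≺β 0
        where
        closed : ∀ {γ} → γ ≺ β → ∃ λ δ → δ ≺ β × W γ δ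
        closed γ≺β with n , γ≼ ← cofinal γ≺β =
          iterate α (suc n) , iterates≺β (suc n) , antitone γ≼ (proj₂ (total (iterate α n)))

  -- Numbers that stand for no element give γ itself, so a value is not always below γ.
  enumerate : ω₁ → ℕ → ω₁
  enumerate γ n with em₀ {∃ λ x → Injection.to (ω₁.countable γ) x ≡ n}
  ... | yes (x , _) = seg γ x
  ... | no _        = γ

  enumerate-surjective : ∀ {ξ γ} → ξ ≺ γ → ∃ λ n → ξ ≅ enumerate γ n
  enumerate-surjective {ξ} {γ} ξ≺γ = to (_≺_.bound ξ≺γ) , iso
    where
    open Injection (ω₁.countable γ) using (to; injective)
    iso : ξ ≅ enumerate γ (to (_≺_.bound ξ≺γ))
    iso with em₀ {∃ λ x → to x ≡ to (_≺_.bound ξ≺γ)}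
    ... | yes (x , eq) = subst (λ x → ξ ≅ seg γ x) (sym (injective eq)) (≺⇒≅seg ξ≺γ)
    ... | no none      = ⊥-elim (none (_ , refl))

  Achieved : ℕ → Program 1 → ω₁ → ℕ → Condition → Condition → Set₁
  Achieved t e ξ m q r = r ⊑ q × Valid r × Property t e ξ m r

  -- δ absorbs everything definable from parameters below γ. Ordinals
  -- without a copy are excluded from `images`, since they vacuously compute
  -- every ordinal.

  record Bounds (γ δ : ω₁) : Set₁ where
    field
      reflects : ∀ t e m {ξ q} → ξ ≺ γ → Inside γ q → ∃ (Achieved t e ξ m q) →
                 ∃ λ r → Achieved t e ξ m q r × Inside δ r
      images   : ∀ {e α β} → β ≺ γ → HasCopy β → e ∣ β ↦ α → α ≺ δ
      larger   : γ ≺ δ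

  Bounds-antitone : ∀ {γ γ′ δ} → γ ≼ γ′ → Bounds γ′ δ → Bounds γ δ
  Bounds-antitone γ≼γ′ b = record
    { reflects = λ t e m ξ≺γ inside → 
        b.reflects t e m (≺-≼-trans ξ≺γ γ≼γ′) (λ i< → ≺-≼-trans (inside i<) γ≼γ′)
    ; images   = λ β≺γ → b.images (≺-≼-trans β≺γ γ≼γ′)
    ; larger   = ≼-≺-trans γ≼γ′ b.larger
    }
    where module b = Bounds b

  Bounds-monotone : ∀ {γ δ δ′} → δ ≺ δ′ → Bounds γ δ → Bounds γ δ′
  Bounds-monotone δ≺δ′ b = record
    { reflects = λ t e m ξ≺γ inside a →
        let r , achieved , inside′ = b.reflects t e m ξ≺γ inside a
        in r , achieved , λ i< → ≺-trans (inside′ i<) δ≺δ′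
    ; images   = λ β≺γ copy e↦ → ≺-trans (b.images β≺γ copy e↦) δ≺δ′
    ; larger   = ≺-trans b.larger δ≺δ′
    }
    where module b = Bounds b

  -- Hilbert's epsilon with a default value: excluded middle for the proof-relevant `∃ P` hands over
  -- a witness.
  choose : {X : Set₁} (P : X → Set₁) → X → X
  choose P x with em {∃ P}
  ... | yes (y , _) = y
  ... | no _        = x

  choose-satisfies : {X : Set₁} (P : X → Set₁) {x : X} → ∃ P → P (choose P x)
  choose-satisfies P Py with em {∃ P}
  ... | yes (_ , Py) = Py
  ... | no none      = ⊥-elim (none Py)

  module _ (γ : ω₁) where

    -- A number `c` codes six parameters of a reflection problem: the property, the functional, the
    -- rank ξ, the element `m`, and the length and the values of the condition.
    task : ℕ → Condition
    task c = condition (c ! 4) (λ i → enumerate γ ((c ! 5) ! i))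

    solves : ℕ → Condition → Set₁
    solves c = Achieved (c ! 0) (functional (c ! 1)) (enumerate γ (c ! 2)) (c ! 3) (task c)

    solution : ℕ → Condition
    solution c = choose (solves c) (task c)

    IsImage : ℕ → ω₁ → Set₁
    IsImage c α = Lift (lsuc 0ℓ) (functional (c ! 0) ∣ enumerate γ (c ! 1) ↦ α)

    image : ℕ → ω₁
    image c = choose (IsImage c) γ

    -- Up to `≅` there are only countably many parameters below γ, so a countable sum absorbs one
    -- solution for each problem, one image for each functional and argument, and γ.
    bound : ω₁
    bound = sum λ { 0 → sum (λ c → sum (val (solution c))) ; 1 → sum image ; _ → γ }

    -- Since β has a copy, its image is unique up to `≅`, and bounding the chosen image bounds them
    -- all.
    image-spec : ∀ c {e α β} → functional (c ! 0) ≡ e → β ≅ enumerate γ (c ! 1) →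
                 HasCopy β → e ∣ β ↦ α → α ≺ bound
    image-spec c {_} {α} {β} refl β≅ (B , copy) e↦ =
      ≅-≺ (↦-unique (B , ≅-trans copy β≅) (↦-cong β≅ e↦)
             (lower (choose-satisfies (IsImage c) (α , lift (↦-cong β≅ e↦)))))
          (≺-trans (≺-sum image c) (≺-sum _ 1))

    -- Decoding recovers `q` and ξ only up to `≅`. Extension in both directions expresses this for
    -- `q`, and the properties are invariant under it.
    solution-spec : ∀ c {t e m ξ q} → c ! 0 ≡ t → functional (c ! 1) ≡ e → c ! 3 ≡ m →
                    ξ ≅ enumerate γ (c ! 2) → task c ⊑ q → q ⊑ task c →
                    ∃ (Achieved t e ξ m q) → ∃ λ r → Achieved t e ξ m q r × Inside bound r
    solution-spec c refl refl refl ξ≅ task⊑q q⊑task (r , r⊑q , valid , x) =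
      solution c ,
      (⊑-trans s⊑task task⊑q , s-valid , Property-cong (c ! 0) (≅-sym ξ≅) s-x) ,
      λ {i} _ → ≺-trans (≺-trans (≺-sum (val (solution c)) i) (≺-sum _ c)) (≺-sum _ 0)
      where
      spec = choose-satisfies (solves c) {task c}
               (r , ⊑-trans r⊑q q⊑task , valid , Property-cong (c ! 0) ξ≅ x)
      s⊑task = proj₁ spec
      s-valid = proj₁ (proj₂ spec)
      s-x = proj₂ (proj₂ spec)

    bound-bounds : Bounds γ bound
    bound-bounds = record { reflects = reflects ; images = images ; larger = ≺-sum _ 2 }
      where
      images : ∀ {e α β} → β ≺ γ → HasCopy β → e ∣ β ↦ α → α ≺ bound
      images {e} {β = β} β≺γ with x , refl ← functional-surjective e
                        | n , β≅ ← enumerate-surjective β≺γ =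
        image-spec (code 2 f) (cong functional (code-! 2 f (s≤s z≤n)))
          (subst (λ k → β ≅ enumerate γ k) (sym (code-! 2 f (s≤s (s≤s z≤n)))) β≅)
        where
        f : ℕ → ℕ
        f 0 = x
        f _ = n

      reflects : ∀ t e m {ξ q} → ξ ≺ γ → Inside γ q → ∃ (Achieved t e ξ m q) →
                 ∃ λ r → Achieved t e ξ m q r × Inside bound r
      reflects t e m {ξ} {q} ξ≺γ inside with x , refl ← functional-surjective e
                                    | n , ξ≅ ← enumerate-surjective ξ≺γ =
        solution-spec c (eq 0) (cong functional (eq 1)) (eq 3)
          (subst (λ k → ξ ≅ enumerate γ k) (sym (eq 2)) ξ≅)
          (extends (ℕ.≤-reflexive (sym (eq 4))) (λ i< → ≅-sym (val≅ i<)))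
          (extends (ℕ.≤-reflexive (eq 4)) (λ i< → val≅ (subst (_ ℕ.<_) (eq 4) i<)))
        where
        index : ℕ → ℕ
        index i with i ℕ.<? len q
        ... | yes i< = proj₁ (enumerate-surjective (inside i<))
        ... | no _   = 0

        index-spec : ∀ {i} → i ℕ.< len q → val q i ≅ enumerate γ (index i)
        index-spec {i} i< with i ℕ.<? len q
        ... | yes i<′ = proj₂ (enumerate-surjective (inside i<′))
        ... | no i≮   = ⊥-elim (i≮ i<)

        f : ℕ → ℕ
        f 0 = t
        f 1 = x
        f 2 = n
        f 3 = m
        f 4 = len q
        f _ = code (len q) index

        c : ℕ
        c = code 6 f

        eq : ∀ i {_ : T (i ℕ.<ᵇ 6)} → c ! i ≡ f i
        eq i {lt} = code-! 6 f (ℕ.<ᵇ⇒< i 6 lt)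

        val≅ : ∀ {i} → i ℕ.< len q → val q i ≅ enumerate γ ((c ! 5) ! i)
        val≅ {i} i< = subst (λ k → val q i ≅ enumerate γ k)
          (sym (trans (cong (_! i) (eq 5)) (code-! (len q) index i<))) (index-spec i<)

-- Generic enumerations

T-extensional : ∀ {a b} → (T a → T b) → (T b → T a) → a ≡ b
T-extensional {false} {false} _ _ = refl
T-extensional {false} {true}  _ g = ⊥-elim (g _)
T-extensional {true}  {false} f _ = ⊥-elim (f _)
T-extensional {true}  {true}  _ _ = refl

append : Condition → ω₁ → Condition
append p b = condition (suc (len p)) val′
  where
  val′ : ℕ → ω₁
  val′ i with i ℕ.<? len p
  ... | yes _ = val p i
  ... | no _  = b

append-old : ∀ p b {i} → i ℕ.< len p → val (append p b) i ≡ val p i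
append-old p b {i} i< with i ℕ.<? len p
... | yes _ = refl
... | no i≮ = ⊥-elim (i≮ i<)

append-new : ∀ p b → val (append p b) (len p) ≡ b
append-new p b with len p ℕ.<? len p
... | yes n<n = ⊥-elim (ℕ.<-irrefl refl n<n)
... | no _    = refl

≡⇒≅ : ∀ {α β} → α ≡ β → α ≅ β
≡⇒≅ {α} refl = ≅-refl {α}

append-⊑ : ∀ p b → append p b ⊑ p
append-⊑ p b = extends (ℕ.n≤1+n _) (≡⇒≅ ∘ append-old p b)

append-valid : ∀ {p b} → Valid p → (∀ {i} → i ℕ.< len p → ¬ val p i ≅ b) → Valid (append p b)
append-valid {p} {b} valid new {i} {j} i< j< eq
  with ℕ.m<1+n⇒m<n∨m≡n i< | ℕ.m<1+n⇒m<n∨m≡n j<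
... | inj₁ i<n  | inj₁ j<n  = valid i<n j<n (subst₂ _≅_ (append-old p b i<n) (append-old p b j<n) eq)
... | inj₁ i<n  | inj₂ refl = ⊥-elim (new i<n (subst₂ _≅_ (append-old p b i<n) (append-new p b) eq))
... | inj₂ refl | inj₁ j<n  = 
  ⊥-elim (new j<n (≅-sym (subst₂ _≅_ (append-new p b) (append-old p b j<n) eq)))
... | inj₂ refl | inj₂ refl = refl

append-inside : ∀ {p b δ} → Inside δ p → b ≺ δ → Inside δ (append p b)
append-inside {p} {b} {δ} inside b≺δ i< with ℕ.m<1+n⇒m<n∨m≡n i<
... | inj₁ i<n  = subst (_≺ δ) (sym (append-old p b i<n)) (inside i<n)
... | inj₂ refl = subst (_≺ δ) (sym (append-new p b)) b≺δ

module Genericity (em : ExcludedMiddle (lsuc 0ℓ)) where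
  open Classical em
  open Bounding em

  Decided : Program 1 → ℕ → ℕ → ω₁ → Condition → Set₁
  Decided e t m ξ p = Property t e ξ m p ⊎ (∀ {r} → r ⊑ p → Valid r → ¬ Property t e ξ m r)

  Contains : ω₁ → Condition → Set
  Contains b p = ∃ λ i → i ℕ.< len p × val p i ≅ b

  -- If some `q` below `p` had no witness at level η beneath it, then `q` would itself be blocked.
  ¬Blocked⇒RankAtLeast : ∀ {e ξ m p} → (∀ {q} → q ⊑ p → Valid q → ¬ Blocked e ξ m q) →
                         RankAtLeast e ξ m p
  ¬Blocked⇒RankAtLeast {e} {m = m} none = rank≥ λ {η} η≺ξ {q} q⊑p q-valid →
    decidable-stable (em {∃ (Achieved 1 e η m q)}) λ stuck →
      none q⊑p q-valid (η , η≺ξ , λ {r} r⊑q r-valid above → stuck (r , r⊑q , r-valid , above))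

  -- A descending sequence meeting just the countably many dense sets that the argument needs. Its
  -- conditions stay inside β, while the negative half of `Decided` speaks of all extensions.
  record Generic (β : ω₁) (e : Program 1) (p₀ : Condition) : Set₁ where
    field
      stage      : ℕ → Condition
      starts     : stage 0 ≡ p₀
      descending : ∀ {m n} → m ℕ.≤ n → stage n ⊑ stage m
      valid      : ∀ n → Valid (stage n)
      inside     : ∀ n → Inside β (stage n)
      long       : ∀ n → n ℕ.< len (stage (suc n))
      contains   : ∀ {b} → b ≺ β → ∃ λ n → Contains b (stage n)
      decided    : ∀ t m {ξ} → ξ ≺ β → ∃ λ n → Decided e t m ξ (stage n)

  module Construction {β : ω₁} (β-closed : Closed Bounds β) (e : Program 1) where

    Good : Condition → Set
    Good p = Valid p × Inside β p

    successor : ∀ {γ} → γ ≺ β → ∃ λ δ → δ ≺ β × γ ≺ δ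
    successor γ≺β with δ , δ≺β , bounds ← proj₂ β-closed γ≺β = δ , δ≺β , Bounds.larger bounds

    common : ∀ {γ δ} → γ ≺ β → δ ≺ β → ∃ λ ε → ε ≺ β × γ ≺ ε × δ ≺ ε
    common {γ} {δ} γ≺β δ≺β with ≺-compare γ δ
    ... | inj₁ γ≺δ        = let ε , ε≺β , δ≺ε = successor δ≺β in ε , ε≺β , ≺-trans γ≺δ δ≺ε , δ≺ε
    ... | inj₂ (inj₁ γ≅δ) = let ε , ε≺β , δ≺ε = successor δ≺β in ε , ε≺β , ≅-≺ γ≅δ δ≺ε , δ≺ε
    ... | inj₂ (inj₂ δ≺γ) = let ε , ε≺β , γ≺ε = successor γ≺β in ε , ε≺β , γ≺ε , ≺-trans δ≺γ γ≺ε

    finite-bound : ∀ n {f : ℕ → ω₁} → (∀ {i} → i ℕ.< n → f i ≺ β) →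
                   ∃ λ ε → ε ≺ β × (∀ {i} → i ℕ.< n → f i ≺ ε)
    -- Even the empty family needs some ordinal below β, which exists because closed ordinals are
    -- nonempty.
    finite-bound zero    _ = _ , seg-≺ β (proj₁ β-closed) , λ ()
    finite-bound (suc n) {f} f≺β
      with ε , ε≺β , f≺ε ← finite-bound n (λ i<n → f≺β (ℕ.m<n⇒m<1+n i<n))
      with ε′ , ε′≺β , ε≺ε′ , fn≺ε′ ← common ε≺β (f≺β (ℕ.n<1+n n)) =
      ε′ , ε′≺β , λ i< → below (ℕ.m<1+n⇒m<n∨m≡n i<)
      where
      below : ∀ {i} → i ℕ.< n ⊎ i ≡ n → f i ≺ ε′
      below (inj₁ i<n)  = ≺-trans (f≺ε i<n) ε≺ε′
      below (inj₂ refl) = fn≺ε′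

    Dense : (Condition → Set₁) → Set₁
    Dense X = ∀ {p} → Good p → ∃ λ q → q ⊑ p × Good q × X q

    -- Finitely many values below β have a strict bound below β, and this bound is a fresh value to
    -- append.
    longer-dense : ∀ n → Dense (λ q → Lift (lsuc 0ℓ) (n ℕ.< len q))
    longer-dense n {p} (valid , inside) = lengthen n
      where
      lengthen : ∀ n → ∃ λ q → q ⊑ p × Good q × Lift (lsuc 0ℓ) (n ℕ.< len q)
      fresh : ∀ {n q} → q ⊑ p → Good q → n ℕ.≤ len q →
              ∃ λ r → r ⊑ p × Good r × Lift (lsuc 0ℓ) (n ℕ.< len r)
      fresh {q = q} q⊑p (valid , inside) n≤
        with ε , ε≺β , q≺ε ← finite-bound (len q) inside =
        append q ε , ⊑-trans (append-⊑ q ε) q⊑p ,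
        (append-valid valid (≺⇒≇ ∘ q≺ε) , append-inside inside ε≺β) , lift (s≤s n≤)
      lengthen zero = fresh ⊑-refl (valid , inside) z≤n
      lengthen (suc n) with q , q⊑p , good , lift n< ← lengthen n = fresh q⊑p good n<

    contains-dense : ∀ {b} → b ≺ β → Dense (λ q → Lift (lsuc 0ℓ) (Contains b q))
    contains-dense {b} b≺β {p} (valid , inside) with em₀ {Contains b p}
    ... | yes c = p , ⊑-refl , (valid , inside) , lift c
    ... | no ¬c = append p b , append-⊑ p b ,
      (append-valid valid (λ i< eq → ¬c (_ , i< , eq)) , append-inside inside b≺β) ,
      lift (len p , ℕ.n<1+n _ , ≡⇒≅ (append-new p b))

    -- This is where reflection enters: if any extension at all has the property, then one inside β
    -- does. The parameters are first gathered below a single γ ≺ β.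
    decided-dense : ∀ t m {ξ} → ξ ≺ β → Dense (Decided e t m ξ)
    decided-dense t m {ξ} ξ≺β {p} (valid , inside) with em {∃ (Achieved t e ξ m p)}
    ... | no none  = p , ⊑-refl , (valid , inside) , inj₂
      λ r⊑p r-valid x → none (_ , r⊑p , r-valid , x)
    ... | yes some
      with ε , ε≺β , p≺ε ← finite-bound (len p) inside
      with γ , γ≺β , ξ≺γ , ε≺γ ← common ξ≺β ε≺β
      with δ , δ≺β , bounds ← proj₂ β-closed γ≺β
      with r , (r⊑p , r-valid , x) , r≺δ ←
             Bounds.reflects bounds t e m ξ≺γ (λ i< → ≺-trans (p≺ε i<) ε≺γ) some =
      r , r⊑p , (r-valid , λ i< → ≺-trans (r≺δ i<) δ≺β) , inj₁ x

    Decided-mono : ∀ t m {ξ p q} → q ⊑ p → Decided e t m ξ p → Decided e t m ξ q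
    Decided-mono t m q⊑p (inj₁ x)    = inj₁ (Property-mono t q⊑p x)
    Decided-mono t m q⊑p (inj₂ none) = inj₂ λ r⊑q → none (⊑-trans r⊑q q⊑p)

    Contains-mono : ∀ {b p q} → q ⊑ p → Contains b p → Contains b q
    Contains-mono q⊑p (i , i< , eq) = i , ℕ.<-≤-trans i< (longer q⊑p) , ≅-trans (agree q⊑p i<) eq

    -- The n-th requirement of each kind. The premises discard numbers for which `enumerate β`
    -- returns its default β.
    record Met (n : ℕ) (q : Condition) : Set₁ where
      field
        long     : n ℕ.< len q
        contains : enumerate β n ≺ β → Contains (enumerate β n) q
        decides  : enumerate β (n ! 2) ≺ β → Decided e (n ! 0) (n ! 1) (enumerate β (n ! 2)) q

    given : ∀ {P : Set} {X : Condition → Set₁} → (P → Dense X) → Dense (λ q → P → X q)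
    given {P} dense {p} good with em₀ {P}
    ... | yes y with q , q⊑p , q-good , x ← dense y good = q , q⊑p , q-good , λ _ → x
    ... | no ¬y = p , ⊑-refl , good , λ y → ⊥-elim (¬y y)

    met-dense : ∀ n → Dense (Met n)
    met-dense n good
      with q , q⊑p , q-good , lift long ← longer-dense n good
      with r , r⊑q , r-good , contains ←
             given {X = λ q → Lift (lsuc 0ℓ) (Contains (enumerate β n) q)} contains-dense q-good
      with s , s⊑r , s-good , decides ←
             given {X = Decided e (n ! 0) (n ! 1) (enumerate β (n ! 2))}
                   (decided-dense (n ! 0) (n ! 1)) r-good =
      s , ⊑-trans s⊑r (⊑-trans r⊑q q⊑p) , s-good , record
        { long     = ℕ.<-≤-trans long (longer (⊑-trans s⊑r r⊑q))
        ; contains = Contains-mono {enumerate β n} s⊑r ∘ lower ∘ contains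
        ; decides  = decides
        }

    module _ {p₀ : Condition} (p₀-good : Good p₀) where

      chain : ℕ → ∃ Good
      chain zero    = p₀ , p₀-good
      chain (suc n) = let q , _ , good , _ = met-dense n (proj₂ (chain n)) in q , good

      met : ∀ n → Met n (proj₁ (chain (suc n)))
      met n = proj₂ (proj₂ (proj₂ (met-dense n (proj₂ (chain n)))))

      chain-descending : ∀ {m n} → m ℕ.≤ n → proj₁ (chain n) ⊑ proj₁ (chain m)
      chain-descending {m} m≤n = go (ℕ.≤⇒≤′ m≤n)
        where
        go : ∀ {n} → m ℕ.≤′ n → proj₁ (chain n) ⊑ proj₁ (chain m)
        go ℕ.≤′-refl           = ⊑-refl
        go (ℕ.≤′-step {n} m≤n) = ⊑-trans (proj₁ (proj₂ (met-dense n (proj₂ (chain n))))) (go m≤n)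

      chain-contains : ∀ {b} → b ≺ β → ∃ λ n → Contains b (proj₁ (chain n))
      chain-contains b≺β
        with n , eq ← enumerate-surjective b≺β
        with i , i< , eq′ ← Met.contains (met n) (≅-≺ (≅-sym eq) b≺β) =
        suc n , i , i< , ≅-trans eq′ (≅-sym eq)

      chain-decided : ∀ t m {ξ} → ξ ≺ β → ∃ λ n → Decided e t m ξ (proj₁ (chain n))
      chain-decided t m {ξ} ξ≺β with k , eq ← enumerate-surjective ξ≺β =
        coded (code 3 f) (code-! 3 f (s≤s z≤n)) (code-! 3 f (s≤s (s≤s z≤n)))
          (subst (λ k → ξ ≅ enumerate β k) (sym (code-! 3 f (s≤s (s≤s (s≤s z≤n))))) eq)
        where
        f : ℕ → ℕ
        f 0 = t
        f 1 = m
        f _ = k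

        coded : ∀ n → n ! 0 ≡ t → n ! 1 ≡ m → ξ ≅ enumerate β (n ! 2) →
                ∃ λ n → Decided e t m ξ (proj₁ (chain n))
        coded n refl refl eq with Met.decides (met n) (≅-≺ (≅-sym eq) ξ≺β)
        ... | inj₁ x    = suc n , inj₁ (Property-cong (n ! 0) (≅-sym eq) x)
        ... | inj₂ none = suc n , inj₂ λ r⊑ valid x → none r⊑ valid (Property-cong (n ! 0) eq x)

      opaque
        generic : Generic β e p₀
        generic = record
          { stage      = proj₁ ∘ chain
          ; starts     = refl
          ; descending = chain-descending
          ; valid      = λ n → proj₁ (proj₂ (chain n))
          ; inside     = λ n → proj₂ (proj₂ (chain n))
          ; long       = λ n → Met.long (met n)
          ; contains   = chain-contains
          ; decided    = chain-decided
          }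

  -- The copy given by a generic enumeration, and forcing equals truth

  module Enumeration {β e p₀} (G : Generic β e p₀) where
    open Generic G renaming (valid to stage-valid; descending to stage-⊑)

    -- Stage `suc i` is certain to be longer than `i`, and later stages change the value only up to
    -- `≅`.
    point : ℕ → ω₁
    point i = val (stage (suc i)) i

    <⇒<len : ∀ {n i} → i ℕ.< n → i ℕ.< len (stage n)
    <⇒<len {i = i} i<n = ℕ.<-≤-trans (Generic.long G i) (longer (stage-⊑ i<n))

    stage-point : ∀ n {i} → i ℕ.< len (stage n) → val (stage n) i ≅ point i
    stage-point n {i} i< with ℕ.≤-total n (suc i)
    ... | inj₁ n≤1+i = ≅-sym (agree (stage-⊑ n≤1+i) i<)
    ... | inj₂ 1+i≤n = agree (stage-⊑ 1+i≤n) (<⇒<len ℕ.≤-refl)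

    point-inside : ∀ i → point i ≺ β
    point-inside i = inside (suc i) (<⇒<len ℕ.≤-refl)

    point-injective : ∀ {i j} → point i ≅ point j → i ≡ j
    point-injective {i} {j} eq = stage-valid n i< j<
      (≅-trans (stage-point n i<) (≅-trans eq (≅-sym (stage-point n j<))))
      where
      n = suc (i ℕ.⊔ j)
      i< = <⇒<len (s≤s (ℕ.m≤m⊔n i j))
      j< = <⇒<len (s≤s (ℕ.m≤n⊔m i j))

    oracle : Subset
    oracle n = isYes (em₀ {point (proj₁ (unpair n)) ≺ point (proj₂ (unpair n))})

    oracle-⟨⟩ : ∀ i j → oracle ⟨ i , j ⟩ ≡ isYes (em₀ {point i ≺ point j})
    oracle-⟨⟩ i j = cong (λ x → isYes (em₀ {point (proj₁ x) ≺ point (proj₂ x)})) (unpair-⟨⟩ i j)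

    diagram⇒≺ : ∀ {i j} → diagram oracle i j → point i ≺ point j
    diagram⇒≺ {i} {j} d = toWitness (subst T (oracle-⟨⟩ i j) d)

    ≺⇒diagram : ∀ {i j} → point i ≺ point j → diagram oracle i j
    ≺⇒diagram {i} {j} lt = subst T (sym (oracle-⟨⟩ i j)) (fromWitness lt)

    agrees : ∀ n → Agrees oracle (stage n)
    agrees n i< j< =
      (λ d → ≅-≺ (stage-point n i<) (≺-≅ (diagram⇒≺ d) (≅-sym (stage-point n j<)))) ,
      (λ lt → ≺⇒diagram (≅-≺ (≅-sym (stage-point n i<)) (≺-≅ lt (stage-point n j<))))

    -- Validity of the stages makes the enumeration injective, and genericity makes it surjective.
    copy : oracle IsCopyOf (ω₁._<_ β)
    copy = mk≅ (λ i → _≺_.bound (point-inside i))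
      (λ {i} {j} eq → point-injective (bound-reflects-≡ (point-inside i) (point-inside j) eq))
      surjective
      (λ {i} {j} d → bound-mono (point-inside i) (point-inside j) (diagram⇒≺ d))
      (λ {i} {j} lt → ≺⇒diagram (bound-reflects-< (point-inside i) (point-inside j) lt))
      where
      surjective : ∀ y → ∃ λ i → _≺_.bound (point-inside i) ≡ y
      surjective y
        with n , i , i< , eq ← contains (seg-≺ β y) =
        i , bound-cong (point-inside i) (seg-≺ β y) (≅-trans (≅-sym (stage-point n i<)) eq)

    module Computed {α D} (Φ≐ : Φ e , oracle ≐ D) (D-copy : D IsCopyOf (ω₁._<_ α)) where

      private
        f = proj₁ D-copy
        open module f = IsOrderIsomorphism (proj₂ D-copy) using (mono; cancel; surjective)

      -- The computation inspects the oracle only below some `N`. A code below `N` has both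
      -- components below `N`, hence within stage `N`, so every oracle agreeing with that stage has
      -- the same bits there.
      diagram⇒forced : ∀ {k m} → diagram D k m → ∃ λ n → Forces e k m (stage n)
      diagram⇒forced {k} {m} k<m
        with N , halts ← ⇓-continuous (subst (λ b → oracle ⊢ e · _ ∷ [] ⇓ bit b)
                           (T-extensional {b = true} _ (λ _ → k<m)) (Φ≐ ⟨ k , m ⟩)) =
        N , λ {C} agrees-C → halts {C} λ {x} x<N → subst (λ x → oracle x ≡ C x) (⟨unpair⟩ x)
          (let i , j = unpair x
               i< = <⇒<len (ℕ.≤-<-trans (subst (i ℕ.≤_) (⟨unpair⟩ x) (m≤⟨m,n⟩ i j)) x<N)
               j< = <⇒<len (ℕ.≤-<-trans (subst (j ℕ.≤_) (⟨unpair⟩ x) (n≤⟨m,n⟩ i j)) x<N)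
               to  , from  = agrees N i< j<
               to′ , from′ = agrees-C i< j<
           in T-extensional (from′ ∘ to) (from ∘ to′))

      forced⇒diagram : ∀ {k m} n → Forces e k m (stage n) → diagram D k m
      forced⇒diagram {k} {m} n forced =
        subst T (sym (bit-injective {b = true}
                       (⇓-deterministic (Φ≐ ⟨ k , m ⟩) (forced (agrees n))))) _

      rank : ℕ → ω₁
      rank m = seg α (f m)

      -- Induction on ξ. If a stage blocked ξ at η, the true order would still have some `k` of rank
      -- η below `m`. Later stages force both facts about `k`, contradicting the block.
      ≼rank⇒forced : ∀ {ξ} m → ξ ≺ β → ξ ≼ rank m → ∃ λ n → RankAtLeast e ξ m (stage n)
      ≼rank⇒forced {ξ} m = go (≺-wellFounded ξ) m
        where
        go : ∀ {ξ} → Acc _≺_ ξ → ∀ m → ξ ≺ β → ξ ≼ rank m → ∃ λ n → RankAtLeast e ξ m (stage n)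
        go {ξ} (acc rs) m ξ≺β ξ≼ with decided 2 m ξ≺β
        ... | n , inj₂ none = n , ¬Blocked⇒RankAtLeast none
        ... | n , inj₁ (η , η≺ξ , none)
          with η≺rank ← ≺-≼-trans η≺ξ ξ≼
          with η≺α ← ≺-trans η≺rank (seg-≺ α (f m))
          with k , fk≡ ← surjective (_≺_.bound η≺α)
          with n₁ , above ← go (rs η≺ξ) k (≺-trans η≺ξ ξ≺β)
                 (≅⇒≼ (subst (λ y → η ≅ seg α y) (sym (fk≡ refl)) (≺⇒≅seg η≺α)))
          with n₂ , forced ← diagram⇒forced {k} {m}
                 (cancel (subst (λ y → ω₁._<_ α y (f m)) (sym (fk≡ refl))
                 (bound-mono η≺α (seg-≺ α (f m)) η≺rank))) =
          ⊥-elim (none {stage N} (stage-⊑ (ℕ.m≤m⊔n n _)) (stage-valid N)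
            (k , (λ {B} → forced {B} ∘ Agrees-mono {B} (stage-⊑ n₂≤N)) ,
             RankAtLeast-mono (stage-⊑ n₁≤N) above))
          where
          N = n ℕ.⊔ (n₁ ℕ.⊔ n₂)
          n₁≤N = ℕ.≤-trans (ℕ.m≤m⊔n n₁ n₂) (ℕ.m≤n⊔m n _)
          n₂≤N = ℕ.≤-trans (ℕ.m≤n⊔m n₁ n₂) (ℕ.m≤n⊔m n _)

      -- Induction on the position of `m` in α, deciding `RankAbove` at the level η = `rank m`,
      -- which α ≺ β puts below β. A witness `k` would have forced rank at least `rank m`, against
      -- induction. The absence of one contradicts a forced ξ above `rank m`.
      forced⇒≼rank : α ≺ β → ∀ {ξ} m n → RankAtLeast e ξ m (stage n) → ξ ≼ rank m
      forced⇒≼rank α≺β m = go (ω₁.wellFounded α (f m))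
        where
        go : ∀ {ξ m} → Acc (ω₁._<_ α) (f m) → ∀ n → RankAtLeast e ξ m (stage n) → ξ ≼ rank m
        go {m = m} (acc rs) n (rank≥ extend) rank≺ξ with decided 1 m (≺-trans (seg-≺ α (f m)) α≺β)
        ... | n′ , inj₁ (k , forced , above) =
          go (rs fk<fm) n′ above (seg-mono α fk<fm)
          where fk<fm = mono (forced⇒diagram {k} {m} n′ (λ {B} → forced {B}))
        ... | n′ , inj₂ none
          with r , r⊑ , r-valid , above ←
                 extend rank≺ξ (stage-⊑ (ℕ.m≤m⊔n n n′)) (stage-valid (n ℕ.⊔ n′)) =
          none (⊑-trans r⊑ (stage-⊑ (ℕ.m≤n⊔m n n′))) r-valid above

-- The antichain

ω : ω₁
ω = record
  { Carrier            = ℕ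
  ; _<_                = ℕ._<_
  ; isStrictTotalOrder = ℕ.<-isStrictTotalOrder
  ; wellFounded        = <-wellFounded
  ; countable          = mk↣ id
  }

module Antichain (em : ExcludedMiddle (lsuc 0ℓ)) where
  open Classical em
  open Bounding em
  open Genericity em

  root : Condition
  root = condition 0 (λ _ → ω)

  root-valid : Valid root
  root-valid ()

  root-inside : ∀ {β} → Inside β root
  root-inside ()

  module _ {β e p} (G : Generic β e p) where
    open Enumeration G
    open Generic G

    -- The element of α′ at position α is some `m` in the computed order. Its rank is α, and truth
    -- is forced at some stage.
    forced-long : ∀ {α α′} → e ∣ β ↦ α′ → α ≺ β → α ≺ α′ → ∃ λ m → ∃ (Achieved 0 e α m p)
    forced-long {α} {α′} e↦ α≺β α≺α′ = forced (compute e↦ oracle copy)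
      where
      forced : (∃ λ D → Φ e , oracle ≐ D × D IsCopyOf (ω₁._<_ α′)) →
               ∃ λ m → ∃ (Achieved 0 e α m p)
      forced (D , Φ≐ , f , iso)
        with m , fm≡ ← IsOrderIsomorphism.surjective iso (_≺_.bound α≺α′)
        with n , long ← Computed.≼rank⇒forced {α′} Φ≐ (f , iso) m α≺β
               (≅⇒≼ (subst (λ y → α ≅ seg α′ y) (sym (fm≡ refl)) (≺⇒≅seg α≺α′))) =
        m , stage n , subst (stage n ⊑_) starts (descending z≤n) , valid n , long

    -- In the order computed from the generic copy, the rank of `m` is a proper segment of α, hence
    -- shorter than the forced rank.
    ¬forced-long : ∀ {α m} → e ∣ β ↦ α → α ≺ β → ¬ RankAtLeast e α m p
    ¬forced-long {α} {m} e↦ α≺β long = refute (compute e↦ oracle copy)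
      where
      refute : ¬ (∃ λ D → Φ e , oracle ≐ D × D IsCopyOf (ω₁._<_ α))
      refute (D , Φ≐ , D-copy) = Computed.forced⇒≼rank Φ≐ D-copy α≺β m 0
        (subst (RankAtLeast e α m) (sym starts) long) (seg-≺ α _)

    generic-hasCopy : HasCopy β
    generic-hasCopy = oracle , copy

  root-generic : ∀ {β} → Closed Bounds β → ∀ e → Generic β e root
  root-generic closed e = Construction.generic closed e (root-valid , root-inside)

  -- Any functional will do here, since only the enumeration matters. The copy is needed to apply
  -- `images`.
  closed-hasCopy : ∀ {β} → Closed Bounds β → HasCopy β
  closed-hasCopy closed = generic-hasCopy (root-generic closed zer)

  -- A condition over β′ forcing a rank α ≺ α′ is reflected below β, where it
  -- lies in a generic copy whose image has no such rank.

  image-not-longer : ∀ {e α α′ β β′} → Closed Bounds β → Closed Bounds β′ →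
                     e ∣ β ↦ α → e ∣ β′ ↦ α′ → α ≺ β → α′ ≺ β′ → ¬ α ≺ α′
  image-not-longer {e} closed closed′ e↦ e↦′ α≺β α′≺β′ α≺α′ =
    let m , achieved = forced-long (root-generic closed′ e) e↦′ (≺-trans α≺α′ α′≺β′) α≺α′
        -- Reflection takes parameters strictly below its first ordinal, so α is first put below
        -- some γ ≺ β.
        γ , γ≺β , γ-bounds = proj₂ closed α≺β
        δ , δ≺β , δ-bounds = proj₂ closed γ≺β
        p , (_ , p-valid , long) , p-inside =
          Bounds.reflects δ-bounds 0 e m (Bounds.larger γ-bounds) root-inside achieved
    in ¬forced-long (Construction.generic closed e {p} (p-valid , λ i< → ≺-trans (p-inside i<) δ≺β))
         e↦ α≺β long

  -- By `image-not-longer` a functional has, up to isomorphism, at most one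
  -- value α that it computes from a longer closed ordinal β.

  Peak : Program 1 → ω₁ → Set₁
  Peak e α = ∃ λ β → Closed Bounds β × α ≺ β × e ∣ β ↦ α

  peak : Program 1 → ω₁
  peak e = choose (Peak e) ω

  Peak-unique : ∀ {e α α′} → Peak e α → Peak e α′ → α ≅ α′
  Peak-unique {e} {α} {α′} (_ , c , α≺ , e↦) (_ , c′ , α′≺ , e↦′) with ≺-compare α α′
  ... | inj₁ α≺α′        = ⊥-elim (image-not-longer c c′ e↦ e↦′ α≺ α′≺ α≺α′)
  ... | inj₂ (inj₁ α≅α′) = α≅α′
  ... | inj₂ (inj₂ α′≺α) = ⊥-elim (image-not-longer c′ c e↦′ e↦ α′≺ α≺ α′≺α)

  peaks : ω₁
  peaks = sum (peak ∘ functional)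

  Peak-bounded : ∀ {e α} → Peak e α → α ≺ peaks
  Peak-bounded {e} {α} p with c , refl ← functional-surjective e =
    ≅-≺ (Peak-unique p (choose-satisfies (Peak e) (α , p))) (≺-sum (peak ∘ functional) c)

  -- The second component does not depend on γ. It lifts all closure points above `peaks`.
  Bounds⁺ : ω₁ → ω₁ → Set₁
  Bounds⁺ γ δ = Bounds γ δ × peaks ≺ δ

  antichain : Pred ω₁ (lsuc 0ℓ)
  antichain = Closed Bounds⁺

  antichain-isClub : IsClub antichain
  antichain-isClub = Closed-isClub
    (λ γ → max (bound γ) peaks ,
           Bounds-monotone (≺-maxˡ _ peaks) (bound-bounds γ) , ≺-maxʳ (bound γ) _)
    (λ γ≼γ′ (bounds , peaks≺) → Bounds-antitone γ≼γ′ bounds , peaks≺)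

  antichain⇒closed : ∀ {β} → antichain β → Closed Bounds β
  antichain⇒closed (x , closed) = x , λ γ≺β →
    let δ , δ≺β , bounds , _ = closed γ≺β in δ , δ≺β , bounds

  peaks≺antichain : ∀ {β} → antichain β → peaks ≺ β
  peaks≺antichain {β} (x , closed) with δ , δ≺β , _ , peaks≺δ ← closed (seg-≺ β x) =
    ≺-trans peaks≺δ δ≺β

  irreducible : ∀ {α β} → antichain α → antichain β → ¬ (α ≅ β) → ¬ (α ≤ₛ β)
  irreducible {α} {β} α∈ β∈ α≇β (e , reduces) with ≺-compare α β
  -- Here α is a value shorter than its argument, so it lies below `peaks`.
  ... | inj₁ α≺β =
    ≺-asym (peaks≺antichain α∈)
      (Peak-bounded {e} (β , antichain⇒closed β∈ , α≺β , uniformly reduces))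
  ... | inj₂ (inj₁ α≅β) = α≇β α≅β
  -- Here α is an image of β ≺ α, so closure puts it below some δ ≺ α.
  ... | inj₂ (inj₂ β≺α)
    with γ , γ≺α , bounds , _ ← proj₂ α∈ β≺α
    with δ , δ≺α , bounds′ , _ ← proj₂ α∈ γ≺α =
    ≺-asym δ≺α (Bounds.images bounds′ (Bounds.larger bounds)
      (closed-hasCopy (antichain⇒closed β∈)) (uniformly reduces))

theorem2 : ExcludedMiddle (lsuc 0ℓ) →
    ∃ λ (A : Pred ω₁ (lsuc 0ℓ)) →
    IsClub A ×
    (∀ {α β} → A α → A β → ¬ (α ≅ β) → ¬ (α ≤ₛ β) × ¬ (β ≤ₛ α))
theorem2 em = antichain , antichain-isClub , λ {α} {β} α∈ β∈ α≇β →
  irreducible {α} {β} α∈ β∈ α≇β , irreducible {β} {α} β∈ α∈ (α≇β ∘ ≅-sym)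
  where open Antichain em
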